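{- Let $G$ be a finite forest with at least one vertex. Then $$\Delta(G)=\max\{|\det\tilde L(G',G'')| : G''\subseteq G'\subseteq G\},$$ where the maximum ranges over subgraphs $G'$ of $G$ (necessarily forests) and induced subgraphs $G''$ of $G'$. Moreover, provided every connected component of $G$ has at least three vertices, the maximum is attained by a pair $(G',G'')$ such that every edge of $G'$ has at least one endpoint in $V(G'')$ and $d_{G'}(v)\ge2$ for all $v\in V(G'')$.
   Context: For a finite simple graph $G$, the elements of $G$ are its vertices and edges. Two elements $\alpha,\beta\in V(G)\cup E(G)$ are incident if $\alpha=\beta$, or one is an edge and the other is an endpoint of that edge. $M(G)$ is the $0/1$ matrix with rows and columns indexed by $V(G)\cup E(G)$ whose $(\alpha,\beta)$ entry is $1$ iff $\alpha$ and $\beta$ are incident; equivalently $M(G)=\begin{bmatrix} I & B\\ B^\intercal & I\end{bmatrix}$ where $B$ is the vertex-edge incidence matrix of $G$. $\Delta(G)$ denotes the maximum of $|\det M'|$ over all square submatrices $M'$ of $M(G)$. For a subgraph $G'$ of $G$ and an induced subgraph $G''$ of $G'$ with vertices $v_1,\dots,v_k$, $\tilde L(G',G'')$ is the $k\times k$ matrix $A(G'')+\mathrm{diag}(d_{G'}(v_1)-1,\dots,d_{G'}(v_k)-1)$, where $A(G'')$ is the adjacency matrix of $G''$ and $d_{G'}(v)$ is the degree of $v$ in $G'$. -}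

module Defs where

open import Data.Nat using (ℕ; zero; suc; _≤_)
open import Data.Integer as ℤ using (ℤ; +_; _*_; _-_; -_; ∣_∣)
import Data.Integer as Z
open import Data.Fin using (Fin; zero; suc; punchIn; inject₁; fromℕ)
open import Data.Fin.Properties using (_≟_)
open import Data.Bool using (Bool; true; false; _∧_; _∨_; if_then_else_)
open import Data.Sum using (_⊎_; inj₁; inj₂)
open import Data.Product using (Σ; _×_; _,_; ∃)
open import Relation.Nullary using (¬_; does)
open import Relation.Binary.PropositionalEquality using (_≡_; _≢_)
open import Function.Definitions using (Injective)

sumℤ : ∀ k → (Fin k → ℤ) → ℤ
sumℤ zero    f = + 0
sumℤ (suc k) f = f zero Z.+ sumℤ k (λ i → f (suc i))

countℕ : ∀ k → (Fin k → Bool) → ℕ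
countℕ zero    f = 0
countℕ (suc k) f = (if f zero then 1 else 0) Data.Nat.+ countℕ k (λ i → f (suc i))

anyFin : ∀ k → (Fin k → Bool) → Bool
anyFin zero    f = false
anyFin (suc k) f = f zero ∨ anyFin k (λ i → f (suc i))

sign : ∀ {k} → Fin k → ℤ
sign zero    = + 1
sign (suc i) = - sign i

Matrix : ℕ → Set
Matrix k = Fin k → Fin k → ℤ

det : ∀ k → Matrix k → ℤ
det zero    A = + 1
det (suc k) A = sumℤ (suc k) (λ j → sign j * A zero j * det k (λ i l → A (suc i) (punchIn j l)))

record Graph : Set where
  field
    n m      : ℕ
    src tgt  : Fin m → Fin n
    loopless : ∀ e → src e ≢ tgt e
    simple   : ∀ e f → ((src e ≡ src f × tgt e ≡ tgt f) ⊎ (src e ≡ tgt f × tgt e ≡ src f)) → e ≡ f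
open Graph public

_==_ : ∀ {k} → Fin k → Fin k → Bool
u == v = does (u ≟ v)

incVE : (G : Graph) → Fin (n G) → Fin (m G) → Bool
incVE G v e = (src G e == v) ∨ (tgt G e == v)

Elem : Graph → Set
Elem G = Fin (n G) ⊎ Fin (m G)

Mentry : (G : Graph) → Elem G → Elem G → ℤ
Mentry G (inj₁ v) (inj₁ w) = if v == w then + 1 else + 0
Mentry G (inj₁ v) (inj₂ e) = if incVE G v e then + 1 else + 0
Mentry G (inj₂ e) (inj₁ v) = if incVE G v e then + 1 else + 0
Mentry G (inj₂ e) (inj₂ f) = if e == f then + 1 else + 0

record SquareSub (G : Graph) : Set where
  field
    size : ℕ
    rows cols : Fin (suc size) → Elem G
    rows-inj : Injective _≡_ _≡_ rows
    cols-inj : Injective _≡_ _≡_ cols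
open SquareSub public

subDetAbs : (G : Graph) → SquareSub G → ℕ
subDetAbs G S = ∣ det (suc (size S)) (λ i j → Mentry G (rows S i) (cols S j)) ∣

IsΔ : Graph → ℕ → Set
IsΔ G d = (Σ (SquareSub G) λ S → subDetAbs G S ≡ d) × (∀ S → subDetAbs G S ≤ d)

Adj : (G : Graph) → Fin (n G) → Fin (n G) → Set
Adj G u v = Σ (Fin (m G)) λ e → (src G e ≡ u × tgt G e ≡ v) ⊎ (src G e ≡ v × tgt G e ≡ u)

record Cycle (G : Graph) : Set where
  field
    len   : ℕ
    vert  : Fin (suc (suc (suc len))) → Fin (n G)
    distinct : Injective _≡_ _≡_ vert
    step  : ∀ (i : Fin (suc (suc len))) → Adj G (vert (inject₁ i)) (vert (suc i))
    close : Adj G (vert (fromℕ (suc (suc len)))) (vert zero)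

IsForest : Graph → Set
IsForest G = ¬ Cycle G

data Reachable (G : Graph) : Fin (n G) → Fin (n G) → Set where
  here : ∀ {v} → Reachable G v v
  there : ∀ {u v w} → Adj G u v → Reachable G v w → Reachable G u w

ComponentsAtLeast3 : Graph → Set
ComponentsAtLeast3 G = ∀ v → Σ (Fin 3 → Fin (n G)) λ f → Injective _≡_ _≡_ f × (∀ i → Reachable G v (f i))

record Subgraph (G : Graph) : Set where
  field
    vs : Fin (n G) → Bool
    es : Fin (m G) → Bool
    closed : ∀ e → es e ≡ true → (vs (src G e) ≡ true) × (vs (tgt G e) ≡ true)
open Subgraph public

deg : (G : Graph) → Subgraph G → Fin (n G) → ℕ
deg G G' v = countℕ (m G) (λ e → es G' e ∧ incVE G v e)

-- u, v adjacent in G' (equivalently in any induced subgraph of G' containing both)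
adjB : (G : Graph) → Subgraph G → Fin (n G) → Fin (n G) → Bool
adjB G G' u v = anyFin (m G) (λ e → es G' e ∧ (((src G e == u) ∧ (tgt G e == v)) ∨ ((src G e == v) ∧ (tgt G e == u))))

record Induced (G : Graph) (G' : Subgraph G) : Set where
  field
    k   : ℕ
    vtx : Fin (suc k) → Fin (n G)
    vtx-inj : Injective _≡_ _≡_ vtx
    vtx-in  : ∀ i → vs G' (vtx i) ≡ true
open Induced public

Ltilde : (G : Graph) (G' : Subgraph G) (G'' : Induced G G') → Matrix (suc (k G''))
Ltilde G G' G'' i j =
  (if adjB G G' (vtx G'' i) (vtx G'' j) then + 1 else + 0)
  Z.+ (if i == j then (+ deg G G' (vtx G'' i)) - + 1 else + 0)

LdetAbs : (G : Graph) (G' : Subgraph G) (G'' : Induced G G') → ℕ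
LdetAbs G G' G'' = ∣ det (suc (k G'')) (Ltilde G G' G'') ∣

IsMaxL : Graph → ℕ → Set
IsMaxL G d =
  (Σ (Subgraph G) λ G' → Σ (Induced G G') λ G'' → LdetAbs G G' G'' ≡ d)
  × (∀ G' G'' → LdetAbs G G' G'' ≤ d)

GoodPair : (G : Graph) (G' : Subgraph G) (G'' : Induced G G') → Set
GoodPair G G' G'' =
  (∀ e → es G' e ≡ true →
     (Σ (Fin (suc (k G''))) λ i → vtx G'' i ≡ src G e) ⊎ (Σ (Fin (suc (k G''))) λ i → vtx G'' i ≡ tgt G e))
  × (∀ i → 2 ≤ deg G G' (vtx G'' i))

{-# OPTIONS --safe #-}
module Submission where

-- M(G) is I + A(T) for the subdivision T of G, which is a forest when G is. Let x have at most one neighbour p in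
-- the rest of T. A row x without column x (or conversely) has a single nonzero entry, and a pivot at (x, x) changes
-- only the diagonal entry of p; hence, by induction and with the diagonal left generic, every minor of D + A(T) is
-- 0 or ± a principal minor. Pivoting on the edges in a principal minor with vertices V'' and edges E' leaves
-- I - BBᵀ = -L̃((V, E'), V''), so the two maxima agree. Given an optimal pair, a vertex of V'' of degree 0 in G' can be
-- dropped, and so can a vertex of degree 1 together with its neighbour (which is in V'', or else the determinant is
-- 0), keeping |det L̃|; edges not meeting V'' do not matter. If V'' becomes empty the maximum is 1, and a star at a
-- vertex of degree at least 2 attains it.

-- A pivot at (x, x) with diagonal entry d would normally divide by d. Here the determinant is used
-- as an affine function of d: it is (d - 1) times the minor without x plus the Schur complement
-- taken at corner 1. Both summands are minors over the smaller forest, but with two different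
-- diagonals. Hence one principal index set and one factor must serve all diagonals at once. Both
-- maxima are compared with a single quantity, `absDet F u`, the absolute determinant of I - BBᵀ
-- with the columns of B restricted to the edge set F and its rows to the vertices u. Here F and u
-- are chosen independently, because `Ltilde` depends on G' only through its edges, so spanning
-- subgraphs represent all choices. The family u may be empty, since dropping vertices can end
-- there, whereas minors and G'' in the statement are nonempty; the value 1 of the empty determinant
-- is also that of a single vertex without edges, so the two conventions have the same maximum.

open import Defs
open import Data.Nat using (ℕ; zero; suc; _≤_; _<_)
import Data.Nat as ℕ
import Data.Nat.Properties as ℕ
open import Data.Integer using (ℤ; +_; -[1+_]; _+_; _*_; _-_; -_; ∣_∣)
open import Data.Integer.Properties
open import Data.Integer.Tactic.RingSolver using (solve-∀)
open import Data.Fin using (Fin; zero; suc; punchIn; punchOut; fromℕ; toℕ; fromℕ<)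
import Data.Fin as Fin
import Data.Fin.Properties as Fin
open import Data.Bool using (Bool; true; false; if_then_else_; _∧_; _∨_; not)
open import Data.Bool.Properties using (∧-zeroʳ; ∧-identityʳ)
import Data.Bool.Properties as Bool
open import Data.List using (List; []; _∷_; allFin)
open import Data.List.Membership.Propositional using (_∈_; _∉_)
open import Data.List.Membership.Propositional.Properties using (∈-allFin)
open import Data.List.Relation.Unary.Any using (here; there; tail)
open import Data.Product using (Σ; ∃; _×_; _,_; proj₁; proj₂)
open import Data.Sum using (_⊎_; inj₁; inj₂; [_,_]′)
import Data.Sum.Properties as Sum
open import Data.Vec using (Vec; []; _∷_; lookup; tabulate)
open import Data.Vec.Properties using (lookup∘tabulate)
open import Data.Vec.Functional using () renaming (_∷_ to _◂_)
open import Function using (_∘_; id)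
open import Function.Definitions using (Injective)
open import Relation.Binary.Definitions using (DecidableEquality; tri<; tri≈; tri>)
open import Relation.Binary.PropositionalEquality
open import Relation.Nullary using (contradiction; does; ¬_; Dec; yes; no; ¬?; _×-dec_; _⊎-dec_; _→-dec_)
open import Relation.Nullary.Decidable using (dec-true; dec-false)
open ≡-Reasoning

-- Determinants

-- Opaque copies of sumℤ and det: were they to unfold at suc k, their function arguments could not be inferred.
opaque
  Sum : ∀ k → (Fin k → ℤ) → ℤ
  Sum = sumℤ

  Det : ∀ k → Matrix k → ℤ
  Det = det

  Det≡det : ∀ k A → Det k A ≡ det k A
  Det≡det k A = refl

  Sum-zero : ∀ f → Sum zero f ≡ + 0
  Sum-zero f = refl

  Sum-suc : ∀ {k} f → Sum (suc k) f ≡ f zero + Sum k (f ∘ suc)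
  Sum-suc f = refl

  Det-zero : ∀ A → Det zero A ≡ + 1
  Det-zero A = refl

  Det-row : ∀ {k} A → Det (suc k) A ≡ Sum (suc k) (λ j → sign j * A zero j * Det k (λ i l → A (suc i) (punchIn j l)))
  Det-row A = refl

  Sum-cong : ∀ {k} {f g : Fin k → ℤ} → (∀ i → f i ≡ g i) → Sum k f ≡ Sum k g
  Sum-cong {zero}  h = refl
  Sum-cong {suc k} h = cong₂ _+_ (h zero) (Sum-cong (h ∘ suc))

  Sum-0 : ∀ {k} {f : Fin k → ℤ} → (∀ i → f i ≡ + 0) → Sum k f ≡ + 0
  Sum-0 {zero}  h = refl
  Sum-0 {suc k} h = cong₂ _+_ (h zero) (Sum-0 (h ∘ suc))

  Sum-+ : ∀ {k} (f g : Fin k → ℤ) → Sum k (λ i → f i + g i) ≡ Sum k f + Sum k g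
  Sum-+ {zero}  f g = refl
  Sum-+ {suc k} f g = trans (cong (λ z → f zero + g zero + z) (Sum-+ (f ∘ suc) (g ∘ suc)))
    (interchange (f zero) (g zero) (Sum k (f ∘ suc)) (Sum k (g ∘ suc)))
    where
    interchange : ∀ a b c d → a + b + (c + d) ≡ a + c + (b + d)
    interchange = solve-∀

  Sum-* : ∀ {k} c (f : Fin k → ℤ) → Sum k (λ i → c * f i) ≡ c * Sum k f
  Sum-* {zero}  c f = sym (*-zeroʳ c)
  Sum-* {suc k} c f = trans (cong (λ z → c * f zero + z) (Sum-* c (f ∘ suc)))
    (sym (*-distribˡ-+ c (f zero) (Sum k (f ∘ suc))))

  Det-cong : ∀ {k} {A B : Matrix k} → (∀ i j → A i j ≡ B i j) → Det k A ≡ Det k B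
  Det-cong {zero}  h = refl
  Det-cong {suc k} h = Sum-cong λ j →
    cong₂ _*_ (cong (sign j *_) (h zero j)) (Det-cong λ i l → h (suc i) (punchIn j l))

Sum-swap : ∀ {k l} (f : Fin k → Fin l → ℤ) →
  Sum k (λ i → Sum l (f i)) ≡ Sum l (λ j → Sum k (λ i → f i j))
Sum-swap {zero}  {l} f = trans (Sum-zero _) (sym (Sum-0 λ j → Sum-zero _))
Sum-swap {suc k} {l} f = begin
  Sum (suc k) (λ i → Sum l (f i))
    ≡⟨ Sum-suc _ ⟩
  Sum l (f zero) + Sum k (λ i → Sum l (f (suc i)))
    ≡⟨ cong (λ z → Sum l (f zero) + z) (Sum-swap (f ∘ suc)) ⟩
  Sum l (f zero) + Sum l (λ j → Sum k (λ i → f (suc i) j))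
    ≡⟨ Sum-+ (f zero) (λ j → Sum k (λ i → f (suc i) j)) ⟨
  Sum l (λ j → f zero j + Sum k (λ i → f (suc i) j))
    ≡⟨ Sum-cong (λ j → sym (Sum-suc _)) ⟩
  Sum l (λ j → Sum (suc k) (λ i → f i j)) ∎

opaque
  unfolding Sum
  Sum-single : ∀ {k} {f : Fin k → ℤ} e → (∀ i → i ≢ e → f i ≡ + 0) → Sum k f ≡ f e
  Sum-single {suc k} {f} zero    h = trans
    (cong (λ z → f zero + z) (Sum-0 λ i → h (suc i) λ ())) (+-identityʳ (f zero))
  Sum-single {suc k} {f} (suc e) h = trans (cong (_+ Sum k (f ∘ suc)) (h zero λ ()))
    (trans (+-identityˡ (Sum k (f ∘ suc))) (Sum-single e λ i i≢e → h (suc i) λ { refl → i≢e refl }))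

-- The corner term is common to both expansions. Expanding the other cofactors of the first row
-- along their first column gives a double sum that is the same when rows and columns exchange
-- roles.
Det-col : ∀ {k} (A : Matrix (suc k)) →
  Det (suc k) A ≡ Sum (suc k) (λ i → sign i * A i zero * Det k (λ a b → A (punchIn i a) (suc b)))
Det-col {zero}  A = trans (Det-row A) (Sum-cong λ { zero → cong (+ 1 * A zero zero *_) (trans (Det-zero _) (sym (Det-zero _))) })
Det-col {suc k} A = begin
  Det (suc (suc k)) A
    ≡⟨ trans (Det-row A) (Sum-suc _) ⟩
  + 1 * A zero zero * Det (suc k) (λ a b → A (suc a) (suc b))
    + Sum (suc k) (λ j → - sign j * A zero (suc j) * Det (suc k) (λ a b → A (suc a) (punchIn (suc j) b)))
    ≡⟨ cong (λ z → + 1 * A zero zero * Det (suc k) (λ a b → A (suc a) (suc b)) + z) tails ⟩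
  + 1 * A zero zero * Det (suc k) (λ a b → A (suc a) (suc b))
    + Sum (suc k) (λ i → - sign i * A (suc i) zero * Det (suc k) (λ a b → A (punchIn (suc i) a) (suc b)))
    ≡⟨ Sum-suc _ ⟨
  Sum (suc (suc k)) (λ i → sign i * A i zero * Det (suc k) (λ a b → A (punchIn i a) (suc b))) ∎
  where
  D : Fin (suc k) → Fin (suc k) → ℤ
  D i j = Det k (λ a b → A (suc (punchIn i a)) (suc (punchIn j b)))
  rearrange : ∀ s t x y d → - t * x * (s * y * d) ≡ - s * y * (t * x * d)
  rearrange = solve-∀
  tails = begin
    Sum (suc k) (λ j → - sign j * A zero (suc j) * Det (suc k) (λ a b → A (suc a) (punchIn (suc j) b)))
      ≡⟨ Sum-cong (λ j → trans
           (cong (- sign j * A zero (suc j) *_) (Det-col (λ a b → A (suc a) (punchIn (suc j) b))))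
           (sym (Sum-* (- sign j * A zero (suc j)) _))) ⟩
    Sum (suc k) (λ j → Sum (suc k) (λ i → - sign j * A zero (suc j) * (sign i * A (suc i) zero * D i j)))
      ≡⟨ Sum-swap (λ j i → - sign j * A zero (suc j) * (sign i * A (suc i) zero * D i j)) ⟩
    Sum (suc k) (λ i → Sum (suc k) (λ j → - sign j * A zero (suc j) * (sign i * A (suc i) zero * D i j)))
      ≡⟨ Sum-cong (λ i → trans
           (Sum-cong λ j → rearrange (sign i) (sign j) (A zero (suc j)) (A (suc i) zero) (D i j))
           (trans (Sum-* (- sign i * A (suc i) zero) (λ j → sign j * A zero (suc j) * D i j))
             (cong (- sign i * A (suc i) zero *_) (sym (Det-row _))))) ⟩
    Sum (suc k) (λ i → - sign i * A (suc i) zero * Det (suc k) (λ a b → A (punchIn (suc i) a) (suc b))) ∎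

Det-transpose : ∀ {k} (A : Matrix k) → Det k (λ i j → A j i) ≡ Det k A
Det-transpose {zero}  A = trans (Det-zero _) (sym (Det-zero _))
Det-transpose {suc k} A = begin
  Det (suc k) (λ i j → A j i)
    ≡⟨ Det-row _ ⟩
  Sum (suc k) (λ j → sign j * A j zero * Det k (λ i l → A (punchIn j l) (suc i)))
    ≡⟨ Sum-cong (λ j → cong (sign j * A j zero *_) (Det-transpose (λ a b → A (punchIn j a) (suc b)))) ⟩
  Sum (suc k) (λ j → sign j * A j zero * Det k (λ a b → A (punchIn j a) (suc b)))
    ≡⟨ Det-col A ⟨
  Det (suc k) A ∎

-- In the expansion along the first column, the terms of the two exchanged rows trade places with
-- opposite signs. The cofactors of all other rows still begin with these two rows, so induction
-- applies to them.
Det-swap : ∀ {k} r s (X : Fin k → Fin (suc (suc k)) → ℤ) →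
  Det (suc (suc k)) (r ◂ s ◂ X) ≡ - Det (suc (suc k)) (s ◂ r ◂ X)
Det-swap {k} r s X = begin
  Det (suc (suc k)) (r ◂ s ◂ X)
    ≡⟨ expand r s ⟩
  + 1 * r zero * P s + (- + 1 * s zero * P r + T X r s)
    ≡⟨ cong (λ q → + 1 * r zero * P s + (- + 1 * s zero * P r + q)) (T-swap X) ⟩
  + 1 * r zero * P s + (- + 1 * s zero * P r + - T X s r)
    ≡⟨ rearrange (r zero) (s zero) (P r) (P s) (T X s r) ⟩
  - (+ 1 * s zero * P r + (- + 1 * r zero * P s + T X s r))
    ≡⟨ cong -_ (expand s r) ⟨
  - Det (suc (suc k)) (s ◂ r ◂ X) ∎
  where
  P : (Fin (suc (suc k)) → ℤ) → ℤ
  P t = Det (suc k) (λ a b → (t ◂ X) a (suc b))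
  T : ∀ {k} (X : Fin k → Fin (suc (suc k)) → ℤ) (t u : Fin (suc (suc k)) → ℤ) → ℤ
  T {k} X t u = Sum k (λ i → - - sign i * X i zero * Det (suc k) (λ a b → (t ◂ u ◂ X) (punchIn (suc (suc i)) a) (suc b)))
  rearrange : ∀ x y p q z → + 1 * x * q + (- + 1 * y * p + - z) ≡ - (+ 1 * y * p + (- + 1 * x * q + z))
  rearrange = solve-∀
  expand : ∀ t u → Det (suc (suc k)) (t ◂ u ◂ X) ≡ + 1 * t zero * P u + (- + 1 * u zero * P t + T X t u)
  expand t u = begin
    Det (suc (suc k)) (t ◂ u ◂ X)
      ≡⟨ trans (Det-col _) (Sum-suc _) ⟩
    + 1 * t zero * P u + Sum (suc k) (λ i → - sign i * (u ◂ X) i zero * Det (suc k) (λ a b → (t ◂ u ◂ X) (punchIn (suc i) a) (suc b)))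
      ≡⟨ cong (λ z → + 1 * t zero * P u + z) (Sum-suc _) ⟩
    + 1 * t zero * P u + (- + 1 * u zero * Det (suc k) (λ a b → (t ◂ u ◂ X) (punchIn (suc zero) a) (suc b)) + T X t u)
      ≡⟨ cong (λ z → + 1 * t zero * P u + (- + 1 * u zero * z + T X t u)) (Det-cong λ { zero b → refl ; (suc a) b → refl }) ⟩
    + 1 * t zero * P u + (- + 1 * u zero * P t + T X t u) ∎
  T-swap : ∀ {k} (X : Fin k → Fin (suc (suc k)) → ℤ) {r s} → T X r s ≡ - T X s r
  T-swap {zero}  X = trans (Sum-zero _) (cong -_ (sym (Sum-zero _)))
  T-swap {suc k} X {r} {s} = trans
    (Sum-cong λ i → trans
      (cong (- - sign i * X i zero *_) (begin
        Det (suc (suc k)) (λ a b → (r ◂ s ◂ X) (punchIn (suc (suc i)) a) (suc b))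
          ≡⟨ Det-cong (λ { zero b → refl ; (suc zero) b → refl ; (suc (suc a)) b → refl }) ⟩
        Det (suc (suc k)) ((r ∘ suc) ◂ (s ∘ suc) ◂ (λ a b → X (punchIn i a) (suc b)))
          ≡⟨ Det-swap (r ∘ suc) (s ∘ suc) (λ a b → X (punchIn i a) (suc b)) ⟩
        - Det (suc (suc k)) ((s ∘ suc) ◂ (r ∘ suc) ◂ (λ a b → X (punchIn i a) (suc b)))
          ≡⟨ cong -_ (Det-cong (λ { zero b → refl ; (suc zero) b → refl ; (suc (suc a)) b → refl })) ⟩
        - Det (suc (suc k)) (λ a b → (s ◂ r ◂ X) (punchIn (suc (suc i)) a) (suc b)) ∎))
      (neg-out (- - sign i * X i zero) _))
    (trans (Sum-* (- + 1) _) (-1*i≡-i (T X s r)))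
    where
    neg-out : ∀ c d → c * - d ≡ - + 1 * (c * d)
    neg-out = solve-∀

toFront : ∀ {k} {X : Set} → Fin (suc k) → (Fin (suc k) → X) → Fin (suc k) → X
toFront i u = u i ◂ (u ∘ punchIn i)

-- Inside the cofactors of the first row, induction brings the chosen row up to second place; one
-- exchange with the first row then adds the last sign.
Det-rowToFront : ∀ {k} i (A : Matrix (suc k)) → Det (suc k) A ≡ sign i * Det (suc k) (toFront i A)
Det-rowToFront zero A = trans
  (Det-cong λ { zero j → refl ; (suc i) j → refl }) (sym (*-identityˡ _))
Det-rowToFront {suc k} (suc i) A = begin
  Det (suc (suc k)) A
    ≡⟨ Det-row A ⟩
  Sum (suc (suc k)) (λ j → sign j * A zero j * Det (suc k) (λ a l → A (suc a) (punchIn j l)))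
    ≡⟨ Sum-cong (λ j → trans
         (cong (sign j * A zero j *_) (trans
           (Det-rowToFront i (λ a l → A (suc a) (punchIn j l)))
           (cong (sign i *_) (Det-cong λ { zero b → refl ; (suc a) b → refl }))))
         (rearrange (sign j) (A zero j) (sign i) _)) ⟩
  Sum (suc (suc k)) (λ j → sign i * (sign j * A zero j * Det (suc k) (λ a l → (A (suc i) ◂ R) a (punchIn j l))))
    ≡⟨ trans (Sum-* (sign i) _) (cong (sign i *_) (sym (Det-row _))) ⟩
  sign i * Det (suc (suc k)) (A zero ◂ A (suc i) ◂ R)
    ≡⟨ cong (sign i *_) (Det-swap (A zero) (A (suc i)) R) ⟩
  sign i * - Det (suc (suc k)) (A (suc i) ◂ A zero ◂ R)
    ≡⟨ trans (sym (neg-distribʳ-* (sign i) _)) (neg-distribˡ-* (sign i) _) ⟩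
  - sign i * Det (suc (suc k)) (A (suc i) ◂ A zero ◂ R)
    ≡⟨ cong (- sign i *_) (Det-cong λ { zero j → refl ; (suc zero) j → refl ; (suc (suc a)) j → refl }) ⟩
  - sign i * Det (suc (suc k)) (toFront (suc i) A) ∎
  where
  R : Fin k → Fin (suc (suc k)) → ℤ
  R a = A (suc (punchIn i a))
  rearrange : ∀ s x t d → s * x * (t * d) ≡ t * (s * x * d)
  rearrange = solve-∀

Det-equalRows : ∀ {k} r (X : Fin k → Fin (suc (suc k)) → ℤ) → Det (suc (suc k)) (r ◂ r ◂ X) ≡ + 0
Det-equalRows r X = i≡-i⇒i≡0 (Det-swap r r X)
  where
  i≡-i⇒i≡0 : ∀ {i} → i ≡ - i → i ≡ + 0
  i≡-i⇒i≡0 {+ zero} e = refl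
  i≡-i⇒i≡0 {+ suc _} ()
  i≡-i⇒i≡0 { -[1+ _ ]} ()

Det-linearRow : ∀ {k} r s t (X : Fin k → Fin (suc k) → ℤ) →
  Det (suc k) ((λ j → r j + t * s j) ◂ X) ≡ Det (suc k) (r ◂ X) + t * Det (suc k) (s ◂ X)
Det-linearRow {k} r s t X = begin
  Det (suc k) ((λ j → r j + t * s j) ◂ X)
    ≡⟨ Det-row _ ⟩
  Sum (suc k) (λ j → sign j * (r j + t * s j) * D j)
    ≡⟨ Sum-cong (λ j → expand (sign j) (r j) t (s j) (D j)) ⟩
  Sum (suc k) (λ j → sign j * r j * D j + t * (sign j * s j * D j))
    ≡⟨ Sum-+ (λ j → sign j * r j * D j) (λ j → t * (sign j * s j * D j)) ⟩
  Sum (suc k) (λ j → sign j * r j * D j) + Sum (suc k) (λ j → t * (sign j * s j * D j))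
    ≡⟨ cong₂ _+_ (sym (Det-row _)) (trans (Sum-* t (λ j → sign j * s j * D j)) (cong (t *_) (sym (Det-row _)))) ⟩
  Det (suc k) (r ◂ X) + t * Det (suc k) (s ◂ X) ∎
  where
  D : Fin (suc k) → ℤ
  D j = Det k (λ i l → X i (punchIn j l))
  expand : ∀ g a t b d → g * (a + t * b) * d ≡ g * a * d + t * (g * b * d)
  expand = solve-∀

-- With `Y zero` exchanged to the top, its cofactors start with a restriction of r, and induction
-- clears the later rows there. The multiple of r left in the top row then drops out by linearity
-- and equality of two rows.
Det-addRowMultiples : ∀ {k} r (t : Fin k → ℤ) (X : Fin k → Fin (suc k) → ℤ) →
  Det (suc k) (r ◂ (λ i j → X i j + t i * r j)) ≡ Det (suc k) (r ◂ X)
Det-addRowMultiples {zero}  r t X = Det-cong λ { zero j → refl }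
Det-addRowMultiples {suc k} r t X = begin
  Det (suc (suc k)) (r ◂ Y)
    ≡⟨ Det-cong (λ { zero j → refl ; (suc zero) j → refl ; (suc (suc i)) j → refl }) ⟩
  Det (suc (suc k)) (r ◂ Y zero ◂ (Y ∘ suc))
    ≡⟨ Det-swap r (Y zero) (Y ∘ suc) ⟩
  - Det (suc (suc k)) (Y zero ◂ r ◂ (Y ∘ suc))
    ≡⟨ cong -_ (trans (Det-row _) (trans (Sum-cong λ j → cong (sign j * Y zero j *_) (begin
         Det (suc k) (λ i l → (r ◂ (Y ∘ suc)) i (punchIn j l))
           ≡⟨ Det-cong (λ { zero l → refl ; (suc i) l → refl }) ⟩
         Det (suc k) ((r ∘ punchIn j) ◂ (λ i l → X (suc i) (punchIn j l) + t (suc i) * r (punchIn j l)))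
           ≡⟨ Det-addRowMultiples (r ∘ punchIn j) (t ∘ suc) (λ i l → X (suc i) (punchIn j l)) ⟩
         Det (suc k) ((r ∘ punchIn j) ◂ (λ i l → X (suc i) (punchIn j l)))
           ≡⟨ Det-cong (λ { zero l → refl ; (suc i) l → refl }) ⟩
         Det (suc k) (λ i l → (r ◂ (X ∘ suc)) i (punchIn j l)) ∎)) (sym (Det-row _)))) ⟩
  - Det (suc (suc k)) (Y zero ◂ r ◂ (X ∘ suc))
    ≡⟨ cong -_ (Det-linearRow (X zero) r (t zero) (r ◂ (X ∘ suc))) ⟩
  - (Det (suc (suc k)) (X zero ◂ r ◂ (X ∘ suc)) + t zero * Det (suc (suc k)) (r ◂ r ◂ (X ∘ suc)))
    ≡⟨ cong (λ z → - (Det (suc (suc k)) (X zero ◂ r ◂ (X ∘ suc)) + t zero * z)) (Det-equalRows r (X ∘ suc)) ⟩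
  - (Det (suc (suc k)) (X zero ◂ r ◂ (X ∘ suc)) + t zero * + 0)
    ≡⟨ cong -_ (vanish (Det (suc (suc k)) (X zero ◂ r ◂ (X ∘ suc))) (t zero)) ⟩
  - Det (suc (suc k)) (X zero ◂ r ◂ (X ∘ suc))
    ≡⟨ Det-swap r (X zero) (X ∘ suc) ⟨
  Det (suc (suc k)) (r ◂ X zero ◂ (X ∘ suc))
    ≡⟨ Det-cong (λ { zero j → refl ; (suc zero) j → refl ; (suc (suc i)) j → refl }) ⟩
  Det (suc (suc k)) (r ◂ X) ∎
  where
  Y : Fin (suc k) → Fin (suc (suc k)) → ℤ
  Y i j = X i j + t i * r j
  vanish : ∀ d t → d + t * + 0 ≡ d
  vanish = solve-∀

minor₀ : ∀ {k} → Matrix (suc k) → Matrix k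
minor₀ A i j = A (suc i) (suc j)

Det-unitCol : ∀ {k} (A : Matrix (suc k)) → (∀ i → A (suc i) zero ≡ + 0) →
  Det (suc k) A ≡ A zero zero * Det k (minor₀ A)
Det-unitCol {k} A h = begin
  Det (suc k) A
    ≡⟨ trans (Det-col A) (Sum-single zero λ
        { zero 0≢0 → contradiction refl 0≢0
        ; (suc i) _ → trans (cong (λ z → - sign i * z * Det k (λ a b → A (punchIn (suc i) a) (suc b))) (h i)) (zeroes (- sign i) _) }) ⟩
  + 1 * A zero zero * Det k (minor₀ A)
    ≡⟨ cong (_* Det k (minor₀ A)) (*-identityˡ (A zero zero)) ⟩
  A zero zero * Det k (minor₀ A) ∎
  where
  zeroes : ∀ s d → s * + 0 * d ≡ + 0
  zeroes = solve-∀

Det-unitRow : ∀ {k} (A : Matrix (suc k)) → (∀ j → A zero (suc j) ≡ + 0) →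
  Det (suc k) A ≡ A zero zero * Det k (minor₀ A)
Det-unitRow A h = trans (sym (Det-transpose A))
  (trans (Det-unitCol (λ i j → A j i) h)
    (cong (A zero zero *_) (Det-transpose (minor₀ A))))

-- Row multiples clear the first column below the corner; the pivot 1 keeps everything integral.
Det-schur : ∀ {k} (A : Matrix (suc k)) → A zero zero ≡ + 1 →
  Det (suc k) A ≡ Det k (λ i j → A (suc i) (suc j) - A (suc i) zero * A zero (suc j))
Det-schur {k} A h = begin
  Det (suc k) A
    ≡⟨ Det-cong (λ { zero j → refl ; (suc i) j → refl }) ⟩
  Det (suc k) (A zero ◂ (A ∘ suc))
    ≡⟨ Det-addRowMultiples (A zero) (λ i → - A (suc i) zero) (A ∘ suc) ⟨
  Det (suc k) B
    ≡⟨ Det-unitCol B (λ i → trans (cong (λ z → A (suc i) zero + - A (suc i) zero * z) h) (cancel (A (suc i) zero))) ⟩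
  A zero zero * Det k (minor₀ B)
    ≡⟨ trans (cong (_* Det k (minor₀ B)) h) (*-identityˡ _) ⟩
  Det k (minor₀ B)
    ≡⟨ Det-cong (λ i j → cong (λ z → A (suc i) (suc j) + z) (sym (neg-distribˡ-* (A (suc i) zero) (A zero (suc j))))) ⟩
  Det k (λ i j → A (suc i) (suc j) - A (suc i) zero * A zero (suc j)) ∎
  where
  B : Matrix (suc k)
  B = A zero ◂ (λ i j → A (suc i) j + - A (suc i) zero * A zero j)
  cancel : ∀ x → x + - x * + 1 ≡ + 0
  cancel = solve-∀

-- The determinant is affine in the corner entry, so Schur's formula at corner 1 gives it for every corner.
Det-corner : ∀ {k} (A : Matrix (suc k)) →
  Det (suc k) A ≡ (A zero zero - + 1) * Det k (minor₀ A)
    + Det k (λ i j → A (suc i) (suc j) - A (suc i) zero * A zero (suc j))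
Det-corner {k} A = begin
  Det (suc k) A
    ≡⟨ trans (Det-row A) (Sum-suc _) ⟩
  + 1 * A zero zero * Det k (minor₀ A) + rest
    ≡⟨ split (A zero zero) (Det k (minor₀ A)) rest ⟩
  (A zero zero - + 1) * Det k (minor₀ A) + (+ 1 * + 1 * Det k (minor₀ A) + rest)
    ≡⟨ cong (λ z → (A zero zero - + 1) * Det k (minor₀ A) + z)
         (trans (sym (trans (Det-row A₁) (Sum-suc _))) (Det-schur A₁ refl)) ⟩
  (A zero zero - + 1) * Det k (minor₀ A)
    + Det k (λ i j → A (suc i) (suc j) - A (suc i) zero * A zero (suc j)) ∎
  where
  A₁ : Matrix (suc k)
  A₁ = (+ 1 ◂ (A zero ∘ suc)) ◂ (A ∘ suc)
  rest : ℤ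
  rest = Sum k (λ j → - sign j * A zero (suc j) * Det k (λ i l → A (suc i) (punchIn (suc j) l)))
  split : ∀ a d z → + 1 * a * d + z ≡ (a - + 1) * d + (+ 1 * + 1 * d + z)
  split = solve-∀

sub : ∀ {X : Set} {k} → (X → X → ℤ) → (r c : Fin k → X) → Matrix k
sub E r c i j = E (r i) (c j)

Det-toFront : ∀ {X : Set} (E : X → X → ℤ) {k} (r c : Fin (suc k) → X) i j →
  Det (suc k) (sub E r c) ≡ sign i * sign j * Det (suc k) (sub E (toFront i r) (toFront j c))
Det-toFront E {k} r c i j = begin
  Det (suc k) (sub E r c)
    ≡⟨ Det-rowToFront i (sub E r c) ⟩
  sign i * Det (suc k) (toFront i (sub E r c))
    ≡⟨ cong (sign i *_) (trans (Det-cong λ { zero b → refl ; (suc a) b → refl })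
         (sym (Det-transpose (sub E (toFront i r) c)))) ⟩
  sign i * Det (suc k) (λ b a → E (toFront i r a) (c b))
    ≡⟨ cong (sign i *_) (Det-rowToFront j (λ b a → E (toFront i r a) (c b))) ⟩
  sign i * (sign j * Det (suc k) (toFront j (λ b a → E (toFront i r a) (c b))))
    ≡⟨ cong (λ z → sign i * (sign j * z)) (trans (Det-cong λ { zero b → refl ; (suc a) b → refl })
         (Det-transpose (sub E (toFront i r) (toFront j c)))) ⟩
  sign i * (sign j * Det (suc k) (sub E (toFront i r) (toFront j c)))
    ≡⟨ *-assoc (sign i) (sign j) _ ⟨
  sign i * sign j * Det (suc k) (sub E (toFront i r) (toFront j c)) ∎

sign²≡1 : ∀ {k} (i : Fin k) → sign i * sign i ≡ + 1
sign²≡1 zero    = refl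
sign²≡1 (suc i) = trans (neg-sq (sign i)) (sign²≡1 i)
  where
  neg-sq : ∀ x → - x * - x ≡ x * x
  neg-sq = solve-∀

∣sign∣≡1 : ∀ {k} (i : Fin k) → ∣ sign i ∣ ≡ 1
∣sign∣≡1 zero    = refl
∣sign∣≡1 (suc i) = trans (∣-i∣≡∣i∣ (sign i)) (∣sign∣≡1 i)

Det-toFront-principal : ∀ {X : Set} (E : X → X → ℤ) {k} (u : Fin (suc k) → X) i →
  Det (suc k) (sub E u u) ≡ Det (suc k) (sub E (toFront i u) (toFront i u))
Det-toFront-principal E {k} u i = trans (Det-toFront E u u i i)
  (trans (cong (_* Det (suc k) (sub E (toFront i u) (toFront i u))) (sign²≡1 i)) (*-identityˡ _))

-- The factor `sign (fromℕ k)` is (-1)^k, in a form that gains one sign with each row expansion.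
Det-neg : ∀ {k} (A : Matrix k) → Det k (λ i j → - A i j) ≡ sign (fromℕ k) * Det k A
Det-neg {zero}  A = trans (Det-zero _) (cong (+ 1 *_) (sym (Det-zero A)))
Det-neg {suc k} A = begin
  Det (suc k) (λ i j → - A i j)
    ≡⟨ Det-row _ ⟩
  Sum (suc k) (λ j → sign j * - A zero j * Det k (λ i l → - A (suc i) (punchIn j l)))
    ≡⟨ Sum-cong (λ j → trans
         (cong (sign j * - A zero j *_) (Det-neg (λ i l → A (suc i) (punchIn j l))))
         (rearrange (sign j) (A zero j) (sign (fromℕ k)) _)) ⟩
  Sum (suc k) (λ j → - sign (fromℕ k) * (sign j * A zero j * Det k (λ i l → A (suc i) (punchIn j l))))
    ≡⟨ trans (Sum-* (- sign (fromℕ k)) _) (cong (- sign (fromℕ k) *_) (sym (Det-row A))) ⟩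
  - sign (fromℕ k) * Det (suc k) A ∎
  where
  rearrange : ∀ s a t d → s * - a * (t * d) ≡ - t * (s * a * d)
  rearrange = solve-∀

∣Det-neg∣ : ∀ {k} (A : Matrix k) → ∣ Det k (λ i j → - A i j) ∣ ≡ ∣ Det k A ∣
∣Det-neg∣ {k} A = begin
  ∣ Det k (λ i j → - A i j) ∣             ≡⟨ cong ∣_∣ (Det-neg A) ⟩
  ∣ sign (fromℕ k) * Det k A ∣            ≡⟨ abs-* (sign (fromℕ k)) (Det k A) ⟩
  ∣ sign (fromℕ k) ∣ ℕ.* ∣ Det k A ∣      ≡⟨ cong (ℕ._* ∣ Det k A ∣) (∣sign∣≡1 (fromℕ k)) ⟩
  1 ℕ.* ∣ Det k A ∣                       ≡⟨ ℕ.*-identityˡ ∣ Det k A ∣ ⟩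
  ∣ Det k A ∣                             ∎

-- Minors of matrices supported on a forest

◂-injective : ∀ {X : Set} {k} {x : X} {u : Fin k → X} →
  (∀ i → u i ≢ x) → Injective _≡_ _≡_ u → Injective _≡_ _≡_ (x ◂ u)
◂-injective x∉u inj {zero}  {zero}  eq = refl
◂-injective x∉u inj {zero}  {suc j} eq = contradiction (sym eq) (x∉u j)
◂-injective x∉u inj {suc i} {zero}  eq = contradiction eq (x∉u i)
◂-injective x∉u inj {suc i} {suc j} eq = cong suc (inj eq)

punchIn-injective : ∀ {X : Set} {k} {u : Fin (suc k) → X} i →
  Injective _≡_ _≡_ u → Injective _≡_ _≡_ (u ∘ punchIn i)
punchIn-injective i inj eq = Fin.punchIn-injective i _ _ (inj eq)

punchIn-avoids : ∀ {X : Set} {k} {u : Fin (suc k) → X} i →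
  Injective _≡_ _≡_ u → ∀ a → u (punchIn i a) ≢ u i
punchIn-avoids i inj a eq = Fin.punchInᵢ≢i i a (inj eq)

module TreeMinors
  {X : Set} (_≟_ : DecidableEquality X)
  (A : X → X → ℤ) (A-sym : ∀ x y → A x y ≡ A y x) (A-abs : ∀ x y → ∣ A x y ∣ ≤ 1)
  where

  -- p is the one possible neighbour of x among the later elements, and arbitrary if there is none.
  data Peeling : List X → Set where
    []   : Peeling []
    peel : ∀ {x L} p → x ∉ L → (∀ {y} → y ∈ L → y ≢ p → A x y ≡ + 0) → Peeling L → Peeling (x ∷ L)

  -- The diagonal is kept apart from A because elimination changes nothing else, so one fixed A
  -- serves the whole induction.
  entry : (X → ℤ) → X → X → ℤ
  entry D x y = if does (x ≟ y) then D x else A x y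

  entry-diag : ∀ D x → entry D x x ≡ D x
  entry-diag D x rewrite dec-true (x ≟ x) refl = refl

  entry-off : ∀ D {x y} → x ≢ y → entry D x y ≡ A x y
  entry-off D {x} {y} x≢y rewrite dec-false (x ≟ y) x≢y = refl

  entry-sym : ∀ D x y → entry D x y ≡ entry D y x
  entry-sym D x y with x ≟ y
  ... | yes refl = sym (entry-diag D x)
  ... | no  x≢y  = trans (A-sym x y) (sym (entry-off D (x≢y ∘ sym)))

  minor : ∀ k → (X → ℤ) → (r c : Fin k → X) → ℤ
  minor k D r c = Det k (sub (entry D) r c)

  eliminate : X → (X → ℤ) → X → ℤ
  eliminate x D y = D y - A x y * A x y

  -- This is `Det-corner` at x. The correction at (y, z) is A x y * A x z, and for distinct y and z
  -- in L one of them differs from p, so only diagonal entries change.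
  minor-eliminate : ∀ {x L p} → x ∉ L → (∀ {y} → y ∈ L → y ≢ p → A x y ≡ + 0) →
    ∀ {k} D (r c : Fin k → X) → (∀ i → r i ∈ L) → (∀ i → c i ∈ L) →
    minor (suc k) D (x ◂ r) (x ◂ c) ≡ (D x - + 1) * minor k D r c + minor k (eliminate x D) r c
  minor-eliminate {x} {L} {p} x∉L nbr {k} D r c r∈ c∈ = begin
    minor (suc k) D (x ◂ r) (x ◂ c)
      ≡⟨ Det-corner _ ⟩
    (entry D x x - + 1) * minor k D r c + Det k (λ i j → entry D (r i) (c j) - entry D (r i) x * entry D x (c j))
      ≡⟨ cong₂ (λ d z → (d - + 1) * minor k D r c + z) (entry-diag D x) (Det-cong λ i j → update (r∈ i) (c∈ j)) ⟩
    (D x - + 1) * minor k D r c + minor k (eliminate x D) r c ∎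
    where
    ≢x : ∀ {y} → y ∈ L → y ≢ x
    ≢x y∈L refl = x∉L y∈L
    product : ∀ {y z} → y ∈ L → z ∈ L → y ≢ z → A x y * A x z ≡ + 0
    product {y} {z} y∈ z∈ y≢z with y ≟ p
    ... | no  y≢p  rewrite nbr y∈ y≢p = *-zeroˡ (A x z)
    ... | yes refl rewrite nbr z∈ (y≢z ∘ sym) = *-zeroʳ (A x y)
    update : ∀ {y z} → y ∈ L → z ∈ L →
      entry D y z - entry D y x * entry D x z ≡ entry (eliminate x D) y z
    update {y} {z} y∈ z∈ = trans
      (cong₂ (λ a b → entry D y z - a * b)
        (trans (entry-off D (≢x y∈)) (A-sym y x)) (entry-off D (≢x z∈ ∘ sym)))
      (by-cases (y ≟ z))
      where
      by-cases : Dec (y ≡ z) → entry D y z - A x y * A x z ≡ entry (eliminate x D) y z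
      by-cases (yes refl) = trans (cong (_- A x y * A x y) (entry-diag D y)) (sym (entry-diag (eliminate x D) y))
      by-cases (no y≢z) = begin
        entry D y z - A x y * A x z ≡⟨ cong₂ _-_ (entry-off D y≢z) (product y∈ z∈ y≢z) ⟩
        A y z - + 0                 ≡⟨ +-identityʳ (A y z) ⟩
        A y z                       ≡⟨ entry-off (eliminate x D) y≢z ⟨
        entry (eliminate x D) y z   ∎

  -- The family `idx` and the factor `ε` are fixed before D, so the same representation can be used
  -- at D and at `eliminate x D`. The value 0 of `ε` accounts for vanishing minors.
  record Principal (L : List X) {k} (r c : Fin k → X) : Set where
    constructor principal
    field
      {size}  : ℕ
      idx     : Fin size → X
      idx-inj : Injective _≡_ _≡_ idx
      idx∈    : ∀ i → idx i ∈ L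
      ε       : ℤ
      ε-abs   : ∣ ε ∣ ≤ 1
      minor≡  : ∀ D → minor k D r c ≡ ε * minor size D idx idx

  ∣*∣≤1 : ∀ a b → ∣ a ∣ ≤ 1 → ∣ b ∣ ≤ 1 → ∣ a * b ∣ ≤ 1
  ∣*∣≤1 a b ha hb = ℕ.≤-trans (ℕ.≤-reflexive (abs-* a b)) (ℕ.*-mono-≤ ha hb)

  ∣sign∣≤1 : ∀ {k} (i : Fin k) → ∣ sign i ∣ ≤ 1
  ∣sign∣≤1 i = ℕ.≤-reflexive (∣sign∣≡1 i)

  Principal-transpose : ∀ {L k} {r c : Fin k → X} → Principal L r c → Principal L c r
  Principal-transpose {r = r} {c} (principal s s-inj s∈ ε ε-abs eq) = principal s s-inj s∈ ε ε-abs λ D →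
    trans (trans (Det-cong λ i j → entry-sym D (c i) (r j)) (Det-transpose (sub (entry D) r c))) (eq D)

  weaken : ∀ {L x k} {r c : Fin k → X} → Principal L r c → Principal (x ∷ L) r c
  weaken (principal s s-inj s∈ ε ε-abs eq) = principal s s-inj (there ∘ s∈) ε ε-abs eq

  MinorsPrincipal : List X → Set
  MinorsPrincipal L = ∀ {k} (r c : Fin k → X) →
    Injective _≡_ _≡_ r → Injective _≡_ _≡_ c → (∀ i → r i ∈ L) → (∀ i → c i ∈ L) → Principal L r c

  module _ {x L p} (x∉L : x ∉ L) (nbr : ∀ {y} → y ∈ L → y ≢ p → A x y ≡ + 0) (IH : MinorsPrincipal L) where

    -- As no column is x, row x contains no diagonal entry and is independent of D. At most its
    -- entry in column p is nonzero, so expansion leaves a constant times a minor over L.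
    peel-row : ∀ {k} (r c : Fin k → X) → Injective _≡_ _≡_ r → Injective _≡_ _≡_ c →
      (∀ i → r i ∈ x ∷ L) → (∀ i → c i ∈ L) → (∃ λ i → r i ≡ x) → Principal (x ∷ L) r c
    peel-row {suc k} r c r-inj c-inj r∈ c∈ (i , refl) = result (IH r′ c′
        (punchIn-injective i r-inj) (punchIn-injective j c-inj)
        (λ a → tail (punchIn-avoids i r-inj a) (r∈ (punchIn i a))) (λ b → c∈ (punchIn j b)))
      where
      pivot : Dec (∃ λ j → c j ≡ p) → ∃ λ j → ∀ l → c (punchIn j l) ≢ p
      pivot (yes (j , refl)) = j , punchIn-avoids j c-inj
      -- Without column p the whole row vanishes, and any column may be split off.
      pivot (no  p∉c)        = zero , λ l eq → p∉c (_ , eq)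
      j : Fin (suc k)
      j = proj₁ (pivot (Fin.any? λ j → c j ≟ p))
      r′ c′ : Fin k → X
      r′ = r ∘ punchIn i
      c′ = c ∘ punchIn j
      ri≢ : ∀ l → r i ≢ c l
      ri≢ l eq = x∉L (subst (_∈ L) (sym eq) (c∈ l))
      row : ∀ D → minor (suc k) D r c ≡ sign i * sign j * (A (r i) (c j) * minor k D r′ c′)
      row D = begin
        minor (suc k) D r c
          ≡⟨ Det-toFront (entry D) r c i j ⟩
        sign i * sign j * Det (suc k) (sub (entry D) (toFront i r) (toFront j c))
          ≡⟨ cong (sign i * sign j *_) (Det-unitRow (sub (entry D) (toFront i r) (toFront j c)) λ l →
               trans (entry-off D (ri≢ (punchIn j l)))
                 (nbr (c∈ (punchIn j l)) (proj₂ (pivot (Fin.any? λ j → c j ≟ p)) l))) ⟩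
        sign i * sign j * (entry D (r i) (c j) * minor k D r′ c′)
          ≡⟨ cong (λ z → sign i * sign j * (z * minor k D r′ c′)) (entry-off D (ri≢ j)) ⟩
        sign i * sign j * (A (r i) (c j) * minor k D r′ c′) ∎
      assoc : ∀ s t a e m → s * t * (a * (e * m)) ≡ s * t * (a * e) * m
      assoc = solve-∀
      result : Principal L r′ c′ → Principal (x ∷ L) r c
      result (principal s s-inj s∈ ε ε-abs eq) = principal s s-inj (there ∘ s∈)
        (sign i * sign j * (A (r i) (c j) * ε))
        (∣*∣≤1 (sign i * sign j) (A (r i) (c j) * ε)
          (∣*∣≤1 (sign i) (sign j) (∣sign∣≤1 i) (∣sign∣≤1 j)) (∣*∣≤1 (A (r i) (c j)) ε (A-abs (r i) (c j)) ε-abs))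
        λ D → trans (row D) (trans (cong (λ z → sign i * sign j * (A (r i) (c j) * z)) (eq D))
          (assoc (sign i) (sign j) (A (r i) (c j)) ε (minor _ D s s)))

    -- The elimination formula is applied forwards to the given minor and backwards to the principal
    -- one. Between the two, the induction hypothesis replaces both summands with the same `s` and
    -- `ε`, once at D and once at `eliminate x D`.
    peel-both : ∀ {k} (r c : Fin k → X) → Injective _≡_ _≡_ r → Injective _≡_ _≡_ c →
      (∀ i → r i ∈ x ∷ L) → (∀ i → c i ∈ x ∷ L) → (∃ λ i → r i ≡ x) → (∃ λ j → c j ≡ x) → Principal (x ∷ L) r c
    peel-both {suc k} r c r-inj c-inj r∈ c∈ (i , refl) (j , cj≡x) = result (IH r′ c′
        (punchIn-injective i r-inj) (punchIn-injective j c-inj) r′∈ c′∈)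
      where
      r′ c′ : Fin k → X
      r′ = r ∘ punchIn i
      c′ = c ∘ punchIn j
      r′∈ : ∀ a → r′ a ∈ L
      r′∈ a = tail (punchIn-avoids i r-inj a) (r∈ (punchIn i a))
      c′∈ : ∀ b → c′ b ∈ L
      c′∈ b = tail (λ eq → punchIn-avoids j c-inj b (trans eq (sym cj≡x))) (c∈ (punchIn j b))
      factor : ∀ s d e m m′ → s * (d * (e * m) + e * m′) ≡ s * e * (d * m + m′)
      factor = solve-∀
      result : Principal L r′ c′ → Principal (x ∷ L) r c
      result (principal {size} s s-inj s∈ ε ε-abs eq) = principal (x ◂ s)
        (◂-injective (λ a eq → x∉L (subst (_∈ L) eq (s∈ a))) s-inj)
        (λ { zero → here refl ; (suc a) → there (s∈ a) })
        (sign i * sign j * ε)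
        (∣*∣≤1 (sign i * sign j) ε (∣*∣≤1 (sign i) (sign j) (∣sign∣≤1 i) (∣sign∣≤1 j)) ε-abs)
        λ D → begin
          minor (suc k) D r c
            ≡⟨ Det-toFront (entry D) r c i j ⟩
          sign i * sign j * Det (suc k) (sub (entry D) (toFront i r) (toFront j c))
            ≡⟨ cong (λ z → sign i * sign j * Det (suc k) (sub (entry D) (x ◂ r′) (z ◂ c′))) cj≡x ⟩
          sign i * sign j * minor (suc k) D (x ◂ r′) (x ◂ c′)
            ≡⟨ cong (sign i * sign j *_) (minor-eliminate x∉L nbr D r′ c′ r′∈ c′∈) ⟩
          sign i * sign j * ((D x - + 1) * minor k D r′ c′ + minor k (eliminate x D) r′ c′)
            ≡⟨ cong₂ (λ a b → sign i * sign j * ((D x - + 1) * a + b)) (eq D) (eq (eliminate x D)) ⟩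
          sign i * sign j * ((D x - + 1) * (ε * minor size D s s) + ε * minor size (eliminate x D) s s)
            ≡⟨ factor (sign i * sign j) (D x - + 1) ε (minor size D s s) (minor size (eliminate x D) s s) ⟩
          sign i * sign j * ε * ((D x - + 1) * minor size D s s + minor size (eliminate x D) s s)
            ≡⟨ cong (sign i * sign j * ε *_) (minor-eliminate x∉L nbr D s s s∈ s∈) ⟨
          sign i * sign j * ε * minor (suc size) D (x ◂ s) (x ◂ s) ∎

  -- Quantifying over the diagonal D is what makes the induction work: eliminating x changes only the diagonal,
  -- by the same amount in the minor and in the principal minor that represents it.
  every-minor-principal : ∀ {L} → Peeling L → MinorsPrincipal L
  every-minor-principal [] {zero} r c r-inj c-inj r∈ c∈ = principal r r-inj r∈ (+ 1) ℕ.≤-refl λ D →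
    trans (Det-zero _) (sym (trans (*-identityˡ _) (Det-zero _)))
  every-minor-principal [] {suc k} r c r-inj c-inj r∈ c∈ with () ← r∈ zero
  every-minor-principal (peel {x} {L} p x∉L nbr P) r c r-inj c-inj r∈ c∈
    with Fin.any? (λ i → r i ≟ x) | Fin.any? (λ j → c j ≟ x)
  ... | no x∉r  | no x∉c  = weaken (every-minor-principal P r c r-inj c-inj
    (λ i → tail (λ eq → x∉r (i , eq)) (r∈ i)) (λ j → tail (λ eq → x∉c (j , eq)) (c∈ j)))
  ... | yes x∈r | no x∉c  = peel-row x∉L nbr (every-minor-principal P) r c r-inj c-inj r∈
    (λ j → tail (λ eq → x∉c (j , eq)) (c∈ j)) x∈r
  ... | no x∉r  | yes x∈c = Principal-transpose (peel-row x∉L nbr (every-minor-principal P) c r c-inj r-inj c∈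
    (λ i → tail (λ eq → x∉r (i , eq)) (r∈ i)) x∈c)
  ... | yes x∈r | yes x∈c = peel-both x∉L nbr (every-minor-principal P) r c r-inj c-inj r∈ c∈ x∈r x∈c

-- Incidence in a graph and the entries of M(G)

module Incidence (G : Graph) where

  V E : Set
  V = Fin (n G)
  E = Fin (m G)

  _≟ᴱ_ : DecidableEquality (Elem G)
  _≟ᴱ_ = Sum.≡-dec Fin._≟_ Fin._≟_

  Inc : V → E → Set
  Inc v e = src G e ≡ v ⊎ tgt G e ≡ v

  inc? : ∀ v e → Dec (Inc v e)
  inc? v e = (src G e Fin.≟ v) ⊎-dec (tgt G e Fin.≟ v)

  Joins : E → V → V → Set
  Joins e u v = (src G e ≡ u × tgt G e ≡ v) ⊎ (src G e ≡ v × tgt G e ≡ u)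

  Joins-sym : ∀ {e u v} → Joins e u v → Joins e v u
  Joins-sym (inj₁ p) = inj₂ p
  Joins-sym (inj₂ p) = inj₁ p

  Joins-irrefl : ∀ {e u} → ¬ Joins e u u
  Joins-irrefl {e} (inj₁ (p , q)) = loopless G e (trans p (sym q))
  Joins-irrefl {e} (inj₂ (p , q)) = loopless G e (trans p (sym q))

  Joins-unique : ∀ {e f u v} → Joins e u v → Joins f u v → e ≡ f
  Joins-unique {e} {f} (inj₁ (refl , refl)) (inj₁ (p , q)) = simple G e f (inj₁ (sym p , sym q))
  Joins-unique {e} {f} (inj₁ (refl , refl)) (inj₂ (p , q)) = simple G e f (inj₂ (sym q , sym p))
  Joins-unique {e} {f} (inj₂ (refl , refl)) (inj₁ (p , q)) = simple G e f (inj₂ (sym q , sym p))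
  Joins-unique {e} {f} (inj₂ (refl , refl)) (inj₂ (p , q)) = simple G e f (inj₁ (sym p , sym q))

  otherEnd : ∀ {v e} → Inc v e → ∃ (Joins e v)
  otherEnd {e = e} (inj₁ p) = tgt G e , inj₁ (p , refl)
  otherEnd {e = e} (inj₂ p) = src G e , inj₂ (refl , p)

  Inc⇒Joins : ∀ {u v e} → u ≢ v → Inc u e → Inc v e → Joins e u v
  Inc⇒Joins u≢v (inj₁ p) (inj₁ q) = contradiction (trans (sym p) q) u≢v
  Inc⇒Joins u≢v (inj₁ p) (inj₂ q) = inj₁ (p , q)
  Inc⇒Joins u≢v (inj₂ p) (inj₁ q) = inj₂ (q , p)
  Inc⇒Joins u≢v (inj₂ p) (inj₂ q) = contradiction (trans (sym p) q) u≢v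

  Joins⇒Incˡ : ∀ {u v e} → Joins e u v → Inc u e
  Joins⇒Incˡ (inj₁ (p , q)) = inj₁ p
  Joins⇒Incˡ (inj₂ (p , q)) = inj₂ q

  Joins-ends : ∀ {u v e t} → Joins e u v → Inc t e → t ≡ u ⊎ t ≡ v
  Joins-ends (inj₁ (p , q)) (inj₁ r) = inj₁ (trans (sym r) p)
  Joins-ends (inj₁ (p , q)) (inj₂ r) = inj₂ (trans (sym r) q)
  Joins-ends (inj₂ (p , q)) (inj₁ r) = inj₂ (trans (sym r) p)
  Joins-ends (inj₂ (p , q)) (inj₂ r) = inj₁ (trans (sym r) q)

  M : Elem G → Elem G → ℤ
  M = Mentry G

  M-inc : ∀ {v e} → Inc v e → M (inj₁ v) (inj₂ e) ≡ + 1
  M-inc {v} {e} i rewrite dec-true (inc? v e) i = refl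

  M-¬inc : ∀ {v e} → ¬ Inc v e → M (inj₁ v) (inj₂ e) ≡ + 0
  M-¬inc {v} {e} ¬i rewrite dec-false (inc? v e) ¬i = refl

  M-diag : ∀ x → M x x ≡ + 1
  M-diag (inj₁ v) rewrite dec-true (v Fin.≟ v) refl = refl
  M-diag (inj₂ e) rewrite dec-true (e Fin.≟ e) refl = refl

  M-vertices : ∀ {u v} → u ≢ v → M (inj₁ u) (inj₁ v) ≡ + 0
  M-vertices {u} {v} u≢v rewrite dec-false (u Fin.≟ v) u≢v = refl

  M-edges : ∀ {e f} → e ≢ f → M (inj₂ e) (inj₂ f) ≡ + 0
  M-edges {e} {f} e≢f rewrite dec-false (e Fin.≟ f) e≢f = refl

  M-sym : ∀ x y → M x y ≡ M y x
  M-sym (inj₁ u) (inj₁ v) with u Fin.≟ v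
  ... | yes refl = sym (M-diag (inj₁ u))
  ... | no u≢v   = sym (M-vertices (u≢v ∘ sym))
  M-sym (inj₁ v) (inj₂ e) = refl
  M-sym (inj₂ e) (inj₁ v) = refl
  M-sym (inj₂ e) (inj₂ f) with e Fin.≟ f
  ... | yes refl = sym (M-diag (inj₂ e))
  ... | no e≢f   = sym (M-edges (e≢f ∘ sym))

  M-abs : ∀ x y → ∣ M x y ∣ ≤ 1
  M-abs = λ
    { (inj₁ u) (inj₁ v) → indicator (u == v)
    ; (inj₁ v) (inj₂ e) → indicator (incVE G v e)
    ; (inj₂ e) (inj₁ v) → indicator (incVE G v e)
    ; (inj₂ e) (inj₂ f) → indicator (e == f) }
    where
    indicator : ∀ b → ∣ (if b then + 1 else + 0) ∣ ≤ 1
    indicator false = ℕ.z≤n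
    indicator true  = ℕ.≤-refl

  open TreeMinors _≟ᴱ_ M M-sym M-abs public

-- Leaf elimination orders of forests

module Peel (G : Graph) (forest : IsForest G) where
  open Incidence G

  module Walk (x : ℕ → V) (via : ℕ → E)
    (joins : ∀ a → Joins (via a) (x a) (x (suc a))) (turns : ∀ a → via a ≢ via (suc a)) where

    no-loop : ∀ a → x a ≢ x (suc a)
    no-loop a eq = Joins-irrefl (subst (Joins (via a) (x a)) (sym eq) (joins a))

    -- Otherwise two successive edges would join the same two vertices and coincide by simplicity,
    -- against `turns`.
    no-backtrack : ∀ a → x a ≢ x (suc (suc a))
    no-backtrack a eq = turns a (Joins-unique (joins a)
      (Joins-sym (subst (Joins (via (suc a)) (x (suc a))) (sym eq) (joins (suc a)))))

    -- A closed subwalk with a repeated vertex contains a shorter one; the bound b makes the descent structural.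
    not-closed : ∀ b g → g < b → ∀ a → x a ≢ x (a ℕ.+ suc g)
    not-closed b zero g<b a eq = no-loop a (trans eq (cong x (ℕ.+-comm a 1)))
    not-closed b (suc zero) g<b a eq = no-backtrack a (trans eq (cong x (ℕ.+-comm a 2)))
    not-closed (suc b) (suc (suc l)) (ℕ.s≤s g≤b) a eq
      with Fin.any? (λ i → Fin.any? λ j → (i Fin.<? j) ×-dec (vert i Fin.≟ vert j))
      where
      vert : Fin (suc (suc (suc l))) → V
      vert i = x (a ℕ.+ toℕ i)
    ... | yes (i , j , i<j , same) with ℕ.m≤n⇒∃[o]m+o≡n i<j
    ... | d , eq-d = not-closed b d d<b (a ℕ.+ toℕ i) (trans same (cong x gap))
      where
      gap : a ℕ.+ toℕ j ≡ a ℕ.+ toℕ i ℕ.+ suc d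
      gap = trans (cong (a ℕ.+_) (trans (sym eq-d) (sym (ℕ.+-suc (toℕ i) d)))) (sym (ℕ.+-assoc a (toℕ i) (suc d)))
      d<b : d < b
      d<b = ℕ.≤-trans (ℕ.≤-trans (ℕ.s≤s (ℕ.m≤n+m d (toℕ i))) (ℕ.≤-trans (ℕ.≤-reflexive eq-d) (Fin.toℕ≤pred[n] j))) g≤b
    not-closed (suc b) (suc (suc l)) (ℕ.s≤s g≤b) a eq | no distinct = forest record
      { len = l
      ; vert = vert
      ; distinct = inj
      ; step = λ i → via (a ℕ.+ toℕ i) , subst₂ (Joins (via (a ℕ.+ toℕ i)))
          (cong (λ t → x (a ℕ.+ t)) (sym (Fin.toℕ-inject₁ i))) (cong x (sym (ℕ.+-suc a (toℕ i)))) (joins (a ℕ.+ toℕ i))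
      ; close = via (a ℕ.+ suc (suc l)) , subst₂ (Joins (via (a ℕ.+ suc (suc l))))
          (cong (λ t → x (a ℕ.+ t)) (sym (Fin.toℕ-fromℕ (suc (suc l)))))
          (trans (cong x (sym (ℕ.+-suc a (suc (suc l))))) (trans (sym eq) (cong x (sym (ℕ.+-identityʳ a)))))
          (joins (a ℕ.+ suc (suc l)))
      }
      where
      vert : Fin (suc (suc (suc l))) → V
      vert i = x (a ℕ.+ toℕ i)
      inj : Injective _≡_ _≡_ vert
      inj {i} {j} same with Fin.<-cmp i j
      ... | tri< i<j _ _ = contradiction (i , j , i<j , same) distinct
      ... | tri≈ _ i≡j _ = i≡j
      ... | tri> _ _ j<i = contradiction (j , i , j<i , sym same) distinct

    -- Among the first n + 1 positions of the walk two carry the same vertex, which closes a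
    -- subwalk.
    impossible : ∀ {A : Set} → A
    impossible with Fin.pigeonhole (ℕ.n<1+n (n G)) (x ∘ toℕ)
    ... | i , j , i<j , same with ℕ.m≤n⇒∃[o]m+o≡n i<j
    ... | d , eq = contradiction (trans same (cong x (trans (sym eq) (sym (ℕ.+-suc (toℕ i) d)))))
                     (not-closed (suc d) d ℕ.≤-refl (toℕ i))

  module Alive {k} (w : Fin k → V) where

    In : V → Set
    In v = ∃ λ i → w i ≡ v

    -- The vertices listed by w span an induced subgraph; its vertices and edges are the elements
    -- still to be peeled.
    EdgeIn : E → Set
    EdgeIn e = In (src G e) × In (tgt G e)

    EdgeAt : V → E → Set
    EdgeAt v e = EdgeIn e × Inc v e

    edgeAt? : ∀ v e → Dec (EdgeAt v e)
    edgeAt? v e = (Fin.any? (λ i → w i Fin.≟ src G e) ×-dec Fin.any? (λ i → w i Fin.≟ tgt G e)) ×-dec inc? v e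

    AliveElem : Elem G → Set
    AliveElem (inj₁ v) = In v
    AliveElem (inj₂ e) = EdgeIn e

    EdgeIn-end : ∀ {e v} → EdgeIn e → Inc v e → In v
    EdgeIn-end (s , t) (inj₁ refl) = s
    EdgeIn-end (s , t) (inj₂ refl) = t

    -- `Leaf` means at most one remaining edge, so isolated vertices are included; this makes the
    -- two cases exhaustive.
    Branch Leaf : V → Set
    Branch v = ∃ λ e → ∃ λ f → EdgeAt v e × EdgeAt v f × e ≢ f
    Leaf v = ∀ e f → EdgeAt v e → EdgeAt v f → e ≡ f

    leaf-or-branch : ∀ v → Leaf v ⊎ Branch v
    leaf-or-branch v with Fin.any? (λ e → Fin.any? λ f → edgeAt? v e ×-dec (edgeAt? v f ×-dec ¬? (e Fin.≟ f)))
    ... | yes branch = inj₂ branch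
    ... | no ¬branch = inj₁ leaf
      where
      leaf : Leaf v
      leaf e f at-e at-f with e Fin.≟ f
      ... | yes e≡f = e≡f
      ... | no e≢f  = contradiction (e , f , at-e , at-f , e≢f) ¬branch

    module _ (branch : ∀ i → Branch (w i)) where

      record State : Set where
        constructor state
        field
          cur   : V
          alive : In cur
          next  : E
          at    : EdgeAt cur next
      open State

      turn : ∀ {v} → In v → ∀ e → ∃ λ f → EdgeAt v f × e ≢ f
      turn (i , refl) e with branch i
      ... | f , g , at-f , at-g , f≢g with e Fin.≟ f
      ... | yes refl = g , at-g , f≢g
      ... | no e≢f   = f , at-f , e≢f

      advance : State → State
      advance (state v v∈ e (e∈ , inc)) with otherEnd inc
      ... | u , uv with EdgeIn-end e∈ (Joins⇒Incˡ (Joins-sym uv))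
      ... | u∈ with turn u∈ e
      ... | f , at-f , _ = state u u∈ f at-f

      advance-joins : ∀ s → Joins (next s) (cur s) (cur (advance s))
      advance-joins (state v v∈ e (e∈ , inc)) = proj₂ (otherEnd inc)

      advance-turns : ∀ s → next s ≢ next (advance s)
      advance-turns (state v v∈ e (e∈ , inc)) =
        proj₂ (proj₂ (turn (EdgeIn-end e∈ (Joins⇒Incˡ (Joins-sym (proj₂ (otherEnd inc))))) e))

      walk : State → ℕ → State
      walk s zero    = s
      walk s (suc a) = advance (walk s a)

      no-start : ¬ State
      no-start s = Walk.impossible (cur ∘ walk s) (next ∘ walk s) (advance-joins ∘ walk s) (advance-turns ∘ walk s)

    -- If every remaining vertex had two remaining edges, each could be left by an edge other than
    -- the one of arrival, giving an endless walk without backtracking.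
    leaf-exists : Fin k → ∃ λ i → Leaf (w i)
    leaf-exists i₀ with Fin.any? (λ i → leaf? (w i))
      where
      leaf? : ∀ v → Dec (Leaf v)
      leaf? v with leaf-or-branch v
      ... | inj₁ leaf = yes leaf
      ... | inj₂ (e , f , at-e , at-f , e≢f) = no λ leaf → e≢f (leaf e f at-e at-f)
    ... | yes found = found
    ... | no ¬leaf = contradiction start (no-start branch)
      where
      branch : ∀ i → Branch (w i)
      branch i with leaf-or-branch (w i)
      ... | inj₁ leaf = contradiction (i , leaf) ¬leaf
      ... | inj₂ b    = b
      start : State branch
      start = state (w i₀) (i₀ , refl) (proj₁ (branch i₀)) (proj₁ (proj₂ (proj₂ (branch i₀))))

  open Alive

  -- A leaf v and its edge e go together: among the remaining elements of the subdivision v meets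
  -- only e, and once v is gone e meets only its other end u. Soundness keeps v and e out of the
  -- rest of the list; completeness makes the final list exhaustive.
  peeling-alive : ∀ k (w : Fin k → V) → Injective _≡_ _≡_ w →
    ∃ λ L → Peeling L × (∀ {x} → x ∈ L → AliveElem w x) × (∀ {x} → AliveElem w x → x ∈ L)
  peeling-alive zero w w-inj = [] , [] , (λ ()) , λ { {inj₁ v} () ; {inj₂ e} (() , _) }
  peeling-alive (suc k) w w-inj with leaf-exists w zero
  ... | i , leaf with peeling-alive k (w ∘ punchIn i) (punchIn-injective i w-inj)
  ... | L , P , sound , complete = result (Fin.any? (edgeAt? w (w i)))
    where
    v : V
    v = w i
    w′ : Fin k → V
    w′ = w ∘ punchIn i
    grow : ∀ {u} → In w′ u → In w u
    grow (a , eq) = punchIn i a , eq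
    grow-edge : ∀ {e} → EdgeIn w′ e → EdgeIn w e
    grow-edge (s , t) = grow s , grow t
    shrink : ∀ {u} → In w u → u ≢ v → In w′ u
    shrink (j , refl) u≢v = punchOut i≢j , cong w (Fin.punchIn-punchOut i≢j)
      where
      i≢j : i ≢ j
      i≢j refl = u≢v refl
    v-dead : ¬ In w′ v
    v-dead (a , eq) = punchIn-avoids i w-inj a eq
    shrink-edge : ∀ {e} → EdgeIn w e → ¬ Inc v e → EdgeIn w′ e
    shrink-edge (s , t) ¬inc = shrink s (¬inc ∘ inj₁) , shrink t (¬inc ∘ inj₂)
    grow-elem : ∀ {x} → AliveElem w′ x → AliveElem w x
    grow-elem {inj₁ u} = grow
    grow-elem {inj₂ e} = grow-edge
    v∉L : inj₁ v ∉ L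
    v∉L = v-dead ∘ sound
    v-isolated : ∀ {y} → y ∈ L → M (inj₁ v) y ≡ + 0
    v-isolated {inj₁ u} u∈ = M-vertices {v} {u} λ { refl → v∉L u∈ }
    v-isolated {inj₂ e} e∈ = M-¬inc (v-dead ∘ EdgeIn-end w′ (sound e∈))
    result : Dec (∃ (EdgeAt w v)) →
      ∃ λ L → Peeling L × (∀ {x} → x ∈ L → AliveElem w x) × (∀ {x} → AliveElem w x → x ∈ L)
    result (no bare) = inj₁ v ∷ L , peel (inj₁ v) v∉L (λ y∈ _ → v-isolated y∈) P , sound₁ , complete₁
      where
      sound₁ : ∀ {x} → x ∈ inj₁ v ∷ L → AliveElem w x
      sound₁ (here refl) = i , refl
      sound₁ (there x∈)  = grow-elem (sound x∈)
      complete₁ : ∀ {x} → AliveElem w x → x ∈ inj₁ v ∷ L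
      complete₁ {inj₁ u} u∈ with u Fin.≟ v
      ... | yes refl = here refl
      ... | no u≢v   = there (complete (shrink u∈ u≢v))
      complete₁ {inj₂ e} e∈ = there (complete (shrink-edge e∈ λ inc → bare (e , e∈ , inc)))
    result (yes (e , e∈ , inc)) with otherEnd inc
    ... | u , vu = inj₁ v ∷ inj₂ e ∷ L
        , peel (inj₂ e) v∉ v-nbr (peel (inj₁ u) e∉L e-nbr P) , sound₂ , complete₂
      where
      e∉L : inj₂ e ∉ L
      e∉L e∈L = v-dead (EdgeIn-end w′ (sound e∈L) inc)
      v∉ : inj₁ v ∉ inj₂ e ∷ L
      v∉ (there v∈) = v∉L v∈
      v-nbr : ∀ {y} → y ∈ inj₂ e ∷ L → y ≢ inj₂ e → M (inj₁ v) y ≡ + 0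
      v-nbr (here eq) y≢e = contradiction eq y≢e
      v-nbr (there y∈) _  = v-isolated y∈
      e-nbr : ∀ {y} → y ∈ L → y ≢ inj₁ u → M (inj₂ e) y ≡ + 0
      e-nbr {inj₁ t} t∈ t≢u = M-¬inc λ inc-t →
        [ (λ { refl → v∉L t∈ }) , (λ { refl → t≢u refl }) ]′ (Joins-ends vu inc-t)
      e-nbr {inj₂ f} f∈ _ = M-edges {e} {f} λ { refl → e∉L f∈ }
      sound₂ : ∀ {x} → x ∈ inj₁ v ∷ inj₂ e ∷ L → AliveElem w x
      sound₂ (here refl)         = i , refl
      sound₂ (there (here refl)) = e∈
      sound₂ (there (there x∈))  = grow-elem (sound x∈)
      complete₂ : ∀ {x} → AliveElem w x → x ∈ inj₁ v ∷ inj₂ e ∷ L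
      complete₂ {inj₁ t} t∈ with t Fin.≟ v
      ... | yes refl = here refl
      ... | no t≢v   = there (there (complete (shrink t∈ t≢v)))
      complete₂ {inj₂ f} f∈ with inc? v f
      ... | yes inc-f = there (here (cong inj₂ (leaf f e (f∈ , inc-f) (e∈ , inc))))
      ... | no ¬inc-f = there (there (complete (shrink-edge f∈ ¬inc-f)))

  peeling : ∃ λ L → Peeling L × (∀ x → x ∈ L)
  peeling with peeling-alive (n G) id id
  ... | L , P , _ , complete = L , P , λ
    { (inj₁ v) → complete (v , refl)
    ; (inj₂ e) → complete ((src G e , refl) , (tgt G e , refl)) }

-- Elimination of edges

does⇒ : ∀ {P : Set} (P? : Dec P) → does P? ≡ true → P
does⇒ (yes p) _ = p

∧-true : ∀ {a b} → a ∧ b ≡ true → a ≡ true × b ≡ true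
∧-true {true} h = refl , h

anyFin-true : ∀ k f → anyFin k f ≡ true → ∃ λ i → f i ≡ true
anyFin-true (suc k) f eq with f zero in f0
... | true  = zero , f0
... | false with anyFin-true k (f ∘ suc) eq
...   | i , fi = suc i , fi

anyFin-false : ∀ k f → anyFin k f ≡ false → ∀ i → f i ≡ false
anyFin-false (suc k) f eq i with f zero in f0
anyFin-false (suc k) f eq zero    | false = f0
anyFin-false (suc k) f eq (suc i) | false = anyFin-false k (f ∘ suc) eq i

Sum-count : ∀ k f → Sum k (λ i → if f i then + 1 else + 0) ≡ + countℕ k f
Sum-count zero    f = Sum-zero _
Sum-count (suc k) f = trans (Sum-suc _) (trans (cong (λ z → (if f zero then + 1 else + 0) + z) (Sum-count k (f ∘ suc))) (lift (f zero)))
  where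
  lift : ∀ b → (if b then + 1 else + 0) + + countℕ k (f ∘ suc) ≡ + ((if b then 1 else 0) ℕ.+ countℕ k (f ∘ suc))
  lift true  = refl
  lift false = refl

module EdgeElimination (G : Graph) where
  open Incidence G

  EdgeSet : Set
  EdgeSet = E → Bool

  term : EdgeSet → Elem G → Elem G → E → ℤ
  term F x y f = if F f then M x (inj₂ f) * M (inj₂ f) y else + 0

  -- The Schur complement of the identity block on F in M.
  K : EdgeSet → Elem G → Elem G → ℤ
  K F x y = M x y - Sum (m G) (term F x y)

  term-0 : ∀ F x y f → (F f ≡ true → M x (inj₂ f) * M (inj₂ f) y ≡ + 0) → term F x y f ≡ + 0
  term-0 F x y f h with F f
  ... | true  = h refl
  ... | false = refl

  K≡M : ∀ F x y → (∀ f → F f ≡ true → M x (inj₂ f) * M (inj₂ f) y ≡ + 0) → K F x y ≡ M x y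
  K≡M F x y h = trans (cong (λ z → M x y - z) (Sum-0 λ f → term-0 F x y f (h f))) (+-identityʳ (M x y))

  K-cong : ∀ {F F′} → (∀ f → F f ≡ F′ f) → ∀ x y → K F x y ≡ K F′ x y
  K-cong eq x y = cong (λ z → M x y - z)
    (Sum-cong λ f → cong (λ b → if b then M x (inj₂ f) * M (inj₂ f) y else + 0) (eq f))

  term-sym : ∀ F x y f → term F x y f ≡ term F y x f
  term-sym F x y f with F f
  ... | true  = trans (cong₂ _*_ (M-sym x (inj₂ f)) (M-sym (inj₂ f) y)) (*-comm (M (inj₂ f) x) (M y (inj₂ f)))
  ... | false = refl

  K-sym : ∀ F x y → K F x y ≡ K F y x
  K-sym F x y = cong₂ _-_ (M-sym x y) (Sum-cong (term-sym F x y))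

  -- The edge block of M is the identity, so eliminating other edges leaves the row of e untouched.
  -- In particular its diagonal entry remains a pivot 1.
  K-edge : ∀ F e y → F e ≡ false → K F (inj₂ e) y ≡ M (inj₂ e) y
  K-edge F e y Fe = K≡M F (inj₂ e) y λ f Ff →
    trans (cong (_* M (inj₂ f) y) (M-edges (e≢f f Ff))) (*-zeroˡ (M (inj₂ f) y))
    where
    e≢f : ∀ f → F f ≡ true → e ≢ f
    e≢f f Ff refl with () ← trans (sym Ff) Fe

  insert remove : E → EdgeSet → EdgeSet
  insert e F f = (f == e) ∨ F f
  remove e F f = not (f == e) ∧ F f

  insert-remove : ∀ {F e} → F e ≡ true → ∀ f → insert e (remove e F) f ≡ F f
  insert-remove {F} {e} Fe f with f Fin.≟ e
  ... | yes refl = sym Fe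
  ... | no _     = refl

  remove-self : ∀ F e → remove e F e ≡ false
  remove-self F e rewrite dec-true (e Fin.≟ e) refl = refl

  remove-⊆ : ∀ F e {f} → remove e F f ≡ true → F f ≡ true × f ≢ e
  remove-⊆ F e {f} h with f Fin.≟ e
  ... | no f≢e = h , f≢e

  K-insert : ∀ F e → F e ≡ false → ∀ x y → K (insert e F) x y ≡ K F x y - M x (inj₂ e) * M (inj₂ e) y
  K-insert F e Fe x y = begin
    M x y - Sum (m G) (term (insert e F) x y)
      ≡⟨ cong (λ z → M x y - z) (trans (Sum-cong split) (Sum-+ new (term F x y))) ⟩
    M x y - (Sum (m G) new + Sum (m G) (term F x y))
      ≡⟨ cong (λ z → M x y - (z + Sum (m G) (term F x y))) (trans (Sum-single e new-0) new-e) ⟩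
    M x y - (M x (inj₂ e) * M (inj₂ e) y + Sum (m G) (term F x y))
      ≡⟨ rearrange (M x y) (M x (inj₂ e) * M (inj₂ e) y) (Sum (m G) (term F x y)) ⟩
    M x y - Sum (m G) (term F x y) - M x (inj₂ e) * M (inj₂ e) y ∎
    where
    new : E → ℤ
    new f = if f == e then M x (inj₂ e) * M (inj₂ e) y else + 0
    new-0 : ∀ f → f ≢ e → new f ≡ + 0
    new-0 f f≢e rewrite dec-false (f Fin.≟ e) f≢e = refl
    new-e : new e ≡ M x (inj₂ e) * M (inj₂ e) y
    new-e rewrite dec-true (e Fin.≟ e) refl = refl
    split : ∀ f → term (insert e F) x y f ≡ new f + term F x y f
    split f with f Fin.≟ e
    ... | yes refl rewrite Fe = sym (+-identityʳ (M x (inj₂ e) * M (inj₂ e) y))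
    ... | no _ = sym (+-identityˡ (term F x y f))
    rearrange : ∀ a b c → a - (b + c) ≡ a - c - b
    rearrange = solve-∀

  K-eliminate : ∀ F e → F e ≡ false → ∀ {k} (s : Fin k → Elem G) →
    Det (suc k) (sub (K F) (inj₂ e ◂ s) (inj₂ e ◂ s)) ≡ Det k (sub (K (insert e F)) s s)
  K-eliminate F e Fe s = trans
    (Det-schur _ (trans (K-edge F e (inj₂ e) Fe) (M-diag (inj₂ e))))
    (Det-cong λ i j → trans
      (cong₂ (λ a b → K F (s i) (s j) - a * b)
        (trans (K-sym F (s i) (inj₂ e)) (trans (K-edge F e (s i) Fe) (M-sym (inj₂ e) (s i))))
        (K-edge F e (s j) Fe))
      (sym (K-insert F e Fe (s i) (s j))))

  Avoids : ∀ {k} → EdgeSet → (Fin k → Elem G) → Set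
  Avoids F s = ∀ i e → s i ≡ inj₂ e → F e ≡ false

  KV : EdgeSet → V → V → ℤ
  KV F u v = K F (inj₁ u) (inj₁ v)

  edge-or-vertex : ∀ {k} (s : Fin k → Elem G) →
    (∃ λ i → ∃ λ e → s i ≡ inj₂ e) ⊎ (∃ λ (u : Fin k → V) → ∀ i → s i ≡ inj₁ (u i))
  edge-or-vertex {zero}  s = inj₂ ((λ ()) , λ ())
  edge-or-vertex {suc k} s with s zero in s0
  ... | inj₂ e = inj₁ (zero , e , s0)
  ... | inj₁ v with edge-or-vertex (s ∘ suc)
  ...   | inj₁ (i , e , eq) = inj₁ (suc i , e , eq)
  ...   | inj₂ (u , eq)     = inj₂ (v ◂ u , λ { zero → s0 ; (suc i) → eq i })

  -- F accumulates the edges already used as pivots. Injectivity of s means that no edge is used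
  -- twice, which keeps `Avoids` valid.
  eliminate-edges : ∀ {k} (s : Fin k → Elem G) → Injective _≡_ _≡_ s → ∀ F → Avoids F s →
    ∃ λ F′ → ∃ λ l → ∃ λ (u : Fin l → V) → Injective _≡_ _≡_ u × Det k (sub (K F) s s) ≡ Det l (sub (KV F′) u u)
  eliminate-edges {k} s s-inj F av with edge-or-vertex s
  ... | inj₂ (u , eq) = F , k , u
    , (λ {i} {j} ui≡uj → s-inj (trans (eq i) (trans (cong inj₁ ui≡uj) (sym (eq j)))))
    , Det-cong λ i j → cong₂ (K F) (eq i) (eq j)
  eliminate-edges {suc k} s s-inj F av | inj₁ (i , e , si≡e)
    with eliminate-edges (s ∘ punchIn i) (punchIn-injective i s-inj) (insert e F) av′
    where
    av′ : Avoids (insert e F) (s ∘ punchIn i)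
    av′ a f eq rewrite dec-false (f Fin.≟ e) (λ { refl → punchIn-avoids i s-inj a (trans eq (sym si≡e)) }) =
      av (punchIn i a) f eq
  ... | F′ , l , u , u-inj , eq = F′ , l , u , u-inj , (begin
    Det (suc k) (sub (K F) s s)
      ≡⟨ Det-toFront-principal (K F) s i ⟩
    Det (suc k) (sub (K F) (toFront i s) (toFront i s))
      ≡⟨ cong (λ x → Det (suc k) (sub (K F) (x ◂ (s ∘ punchIn i)) (x ◂ (s ∘ punchIn i)))) si≡e ⟩
    Det (suc k) (sub (K F) (inj₂ e ◂ (s ∘ punchIn i)) (inj₂ e ◂ (s ∘ punchIn i)))
      ≡⟨ K-eliminate F e (av i e si≡e) (s ∘ punchIn i) ⟩
    Det k (sub (K (insert e F)) (s ∘ punchIn i) (s ∘ punchIn i))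
      ≡⟨ eq ⟩
    Det l (sub (KV F′) u u) ∎)

  -- `K-eliminate` read backwards: each edge of F returns as a row and column index, until F is
  -- empty and K is M. The list `es` bounds F and carries the recursion.
  introduce-edges : ∀ (es : List E) F → (∀ f → F f ≡ true → f ∈ es) →
    ∀ {k} (s : Fin (suc k) → Elem G) → Injective _≡_ _≡_ s → Avoids F s →
    ∃ λ l → ∃ λ (s′ : Fin (suc l) → Elem G) →
      Injective _≡_ _≡_ s′ × Det (suc l) (sub M s′ s′) ≡ Det (suc k) (sub (K F) s s)
  introduce-edges [] F F⊆ {k} s s-inj av = k , s , s-inj , Det-cong λ i j →
    sym (K≡M F (s i) (s j) λ f Ff → contradiction (F⊆ f Ff) λ ())
  introduce-edges (e ∷ es) F F⊆ {k} s s-inj av with F e in Fe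
  ... | false = introduce-edges es F (λ f Ff → tail (λ { refl → contradiction (trans (sym Ff) Fe) λ () }) (F⊆ f Ff)) s s-inj av
  ... | true with introduce-edges es (remove e F)
                    (λ f Rf → tail (proj₂ (remove-⊆ F e Rf)) (F⊆ f (proj₁ (remove-⊆ F e Rf))))
                    (inj₂ e ◂ s) (◂-injective (λ i eq → contradiction (trans (sym Fe) (av i e eq)) λ ()) s-inj) av′
    where
    av′ : Avoids (remove e F) (inj₂ e ◂ s)
    av′ zero    .e refl = remove-self F e
    av′ (suc i) f  eq   = trans (cong (not (f == e) ∧_) (av i f eq)) (∧-zeroʳ (not (f == e)))
  ... | l , s′ , s′-inj , eq = l , s′ , s′-inj , trans eq (trans
    (K-eliminate (remove e F) e (remove-self F e) s)
    (Det-cong λ i j → K-cong (insert-remove Fe) (s i) (s j)))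

  module _ (G′ : Subgraph G) where

    F : EdgeSet
    F = es G′

    Sum-deg : ∀ v → Sum (m G) (term F (inj₁ v) (inj₁ v)) ≡ + deg G G′ v
    Sum-deg v = trans (Sum-cong λ f → indicator f) (Sum-count (m G) _)
      where
      indicator : ∀ f → term F (inj₁ v) (inj₁ v) f ≡ (if F f ∧ incVE G v f then + 1 else + 0)
      indicator f with F f
      ... | false = refl
      ... | true with incVE G v f
      ...   | true  = refl
      ...   | false = refl

    joins? : ∀ e u v → Dec (Joins e u v)
    joins? e u v = ((src G e Fin.≟ u) ×-dec (tgt G e Fin.≟ v)) ⊎-dec ((src G e Fin.≟ v) ×-dec (tgt G e Fin.≟ u))

    product-0 : ∀ {u v f} → u ≢ v → ¬ Joins f u v → M (inj₁ u) (inj₂ f) * M (inj₂ f) (inj₁ v) ≡ + 0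
    product-0 {u} {v} {f} u≢v ¬joins with inc? u f | inc? v f
    ... | no ¬p | _     = trans (cong (_* M (inj₂ f) (inj₁ v)) (M-¬inc ¬p)) (*-zeroˡ (M (inj₂ f) (inj₁ v)))
    ... | yes _ | no ¬q = trans (cong (M (inj₁ u) (inj₂ f) *_) (M-¬inc ¬q)) (*-zeroʳ (M (inj₁ u) (inj₂ f)))
    ... | yes p | yes q = contradiction (Inc⇒Joins u≢v p q) ¬joins

    -- Only an edge joining u and v contributes, and simplicity allows at most one.
    Sum-adj : ∀ {u v} → u ≢ v → Sum (m G) (term F (inj₁ u) (inj₁ v)) ≡ (if adjB G G′ u v then + 1 else + 0)
    Sum-adj {u} {v} u≢v with adjB G G′ u v in eq
    ... | false = Sum-0 λ f → term-0 F (inj₁ u) (inj₁ v) f λ Ff → product-0 u≢v λ joins →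
      contradiction (trans (sym (cong₂ _∧_ Ff (dec-true (joins? f u v) joins))) (anyFin-false (m G) _ eq f)) λ ()
    ... | true with anyFin-true (m G) _ eq
    ...   | e , h = trans (Sum-single e λ f f≢e → term-0 F (inj₁ u) (inj₁ v) f λ _ →
        product-0 u≢v λ joins-f → f≢e (Joins-unique joins-f joins)) at-e
      where
      joins : Joins e u v
      joins = does⇒ (joins? e u v) (proj₂ (∧-true {F e} h))
      at-e : term F (inj₁ u) (inj₁ v) e ≡ + 1
      at-e rewrite proj₁ (∧-true {F e} h) = cong₂ _*_ (M-inc (Joins⇒Incˡ joins)) (M-inc (Joins⇒Incˡ (Joins-sym joins)))

    adjB-irrefl : ∀ v → adjB G G′ v v ≡ false
    adjB-irrefl v with adjB G G′ v v in eq
    ... | false = refl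
    ... | true with anyFin-true (m G) _ eq
    ...   | e , h = contradiction (does⇒ (joins? e v v) (proj₂ (∧-true {F e} h))) Joins-irrefl

    KV≡-Ltilde : ∀ G″ i j → KV F (vtx G″ i) (vtx G″ j) ≡ - Ltilde G G′ G″ i j
    KV≡-Ltilde G″ i j with i Fin.≟ j
    ... | yes refl rewrite adjB-irrefl (vtx G″ i) = trans
      (cong₂ _-_ (M-diag (inj₁ (vtx G″ i))) (Sum-deg (vtx G″ i))) (diagonal (+ deg G G′ (vtx G″ i)))
      where
      diagonal : ∀ d → + 1 - d ≡ - (+ 0 + (d - + 1))
      diagonal = solve-∀
    ... | no i≢j = trans
      (cong₂ _-_ (M-vertices u≢v) (Sum-adj u≢v))
      (off-diagonal (if adjB G G′ (vtx G″ i) (vtx G″ j) then + 1 else + 0))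
      where
      u≢v : vtx G″ i ≢ vtx G″ j
      u≢v = i≢j ∘ vtx-inj G″
      off-diagonal : ∀ a → + 0 - a ≡ - (a + + 0)
      off-diagonal = solve-∀

    LdetAbs≡ : ∀ G″ → LdetAbs G G′ G″ ≡ ∣ Det _ (sub (KV F) (vtx G″) (vtx G″)) ∣
    LdetAbs≡ G″ = sym (begin
      ∣ Det _ (sub (KV F) (vtx G″) (vtx G″)) ∣ ≡⟨ cong ∣_∣ (Det-cong (KV≡-Ltilde G″)) ⟩
      ∣ Det _ (λ i j → - Ltilde G G′ G″ i j) ∣ ≡⟨ ∣Det-neg∣ (Ltilde G G′ G″) ⟩
      ∣ Det _ (Ltilde G G′ G″) ∣               ≡⟨ cong ∣_∣ (Det≡det _ (Ltilde G G′ G″)) ⟩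
      LdetAbs G G′ G″ ∎)

-- Existence and shape of an optimal pair

-- Nonempty finiteness, phrased so that it passes to dependent pairs and vectors without an
-- enumeration.
HasMax : Set → Set
HasMax X = ∀ (f : X → ℕ) → ∃ λ x → ∀ y → f y ≤ f x

Bool-max : HasMax Bool
Bool-max f with ℕ.≤-total (f false) (f true)
... | inj₁ le = true  , λ { true → ℕ.≤-refl ; false → le }
... | inj₂ le = false , λ { true → le ; false → ℕ.≤-refl }

Fin-max : ∀ {n} → 1 ≤ n → HasMax (Fin n)
Fin-max {suc zero}    _ f = zero , λ { zero → ℕ.≤-refl }
Fin-max {suc (suc n)} _ f with Fin-max {suc n} (ℕ.s≤s ℕ.z≤n) (f ∘ suc)
... | i , best with ℕ.≤-total (f zero) (f (suc i))
...   | inj₁ le = suc i , λ { zero → le ; (suc j) → best j }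
...   | inj₂ le = zero  , λ { zero → ℕ.≤-refl ; (suc j) → ℕ.≤-trans (best j) le }

Σ-max : ∀ {X : Set} {Y : X → Set} → HasMax X → (∀ x → HasMax (Y x)) → HasMax (Σ X Y)
Σ-max maxX maxY f with maxX (λ x → f (x , proj₁ (maxY x λ y → f (x , y))))
... | x , best = (x , proj₁ (maxY x λ y → f (x , y))) , λ { (x′ , y′) →
  ℕ.≤-trans (proj₂ (maxY x′ λ y → f (x′ , y)) y′) (best x′) }

Vec-max : ∀ {X : Set} → HasMax X → ∀ k → HasMax (Vec X k)
Vec-max maxX zero    f = [] , λ { [] → ℕ.≤-refl }
Vec-max maxX (suc k) f with Σ-max maxX (λ _ → Vec-max maxX k) (λ { (x , xs) → f (x ∷ xs) })
... | (x , xs) , best = x ∷ xs , λ { (y ∷ ys) → best (y , ys) }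

count≥1 : ∀ k f i → f i ≡ true → 1 ≤ countℕ k f
count≥1 (suc k) f zero    fi rewrite fi = ℕ.s≤s ℕ.z≤n
count≥1 (suc k) f (suc i) fi = ℕ.≤-trans (count≥1 k (f ∘ suc) i fi) (ℕ.m≤n+m _ _)

count≥2 : ∀ k f i j → i ≢ j → f i ≡ true → f j ≡ true → 2 ≤ countℕ k f
count≥2 (suc k) f zero    zero    i≢j fi fj = contradiction refl i≢j
count≥2 (suc k) f zero    (suc j) i≢j fi fj rewrite fi = ℕ.s≤s (count≥1 k (f ∘ suc) j fj)
count≥2 (suc k) f (suc i) zero    i≢j fi fj rewrite fj = ℕ.s≤s (count≥1 k (f ∘ suc) i fi)
count≥2 (suc k) f (suc i) (suc j) i≢j fi fj =
  ℕ.≤-trans (count≥2 k (f ∘ suc) i j (i≢j ∘ cong suc) fi fj) (ℕ.m≤n+m _ _)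

module Pairs (G : Graph) where
  open Incidence G
  open EdgeElimination G

  spanning : EdgeSet → Subgraph G
  spanning F = record { vs = λ _ → true ; es = F ; closed = λ _ _ → refl , refl }

  induced : ∀ F {k} (u : Fin (suc k) → V) → Injective _≡_ _≡_ u → Induced G (spanning F)
  induced F {k} u u-inj = record { k = k ; vtx = u ; vtx-inj = u-inj ; vtx-in = λ _ → refl }

  absDet : EdgeSet → ∀ {k} → (Fin k → V) → ℕ
  absDet F {k} u = ∣ Det k (sub (KV F) u u) ∣

  absDet-cong : ∀ {F F′ k} {u u′ : Fin k → V} → (∀ f → F f ≡ F′ f) → (∀ i → u i ≡ u′ i) → absDet F u ≡ absDet F′ u′
  absDet-cong {F} {F′} {u = u} eqF equ = cong ∣_∣ (Det-cong λ i j →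
    trans (K-cong eqF (inj₁ (u i)) (inj₁ (u j))) (cong₂ (KV F′) (equ i) (equ j)))

  absDet-empty : ∀ F (u : Fin 0 → V) → absDet F u ≡ 1
  absDet-empty F u = cong ∣_∣ (Det-zero _)

  absDet-single : ∀ v → absDet (λ _ → false) {1} (λ _ → v) ≡ 1
  absDet-single v = cong ∣_∣ (trans (Det-unitRow _ λ ())
    (cong₂ _*_ (trans (K≡M (λ _ → false) (inj₁ v) (inj₁ v) λ _ ()) (M-diag (inj₁ v))) (Det-zero _)))

  -- `verts` is nonempty, as G'' must be, but it is compared with families of every length,
  -- including the empty one.
  record Optimum : Set where
    field
      edges   : EdgeSet
      {size}  : ℕ
      verts   : Fin (suc size) → V
      inj     : Injective _≡_ _≡_ verts
      optimal : ∀ F {k} (u : Fin k → V) → Injective _≡_ _≡_ u → absDet F u ≤ absDet edges verts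

  injective? : ∀ {k} (u : Fin k → V) → Dec (∀ i j → u i ≡ u j → i ≡ j)
  injective? u = Fin.all? λ i → Fin.all? λ j → (u i Fin.≟ u j) →-dec (i Fin.≟ j)

  -- Vectors replace functions so that the search space is finite up to propositional equality. The
  -- lengths are exactly 1 to n, all that an injective nonempty family of vertices can have.
  Candidate : Set
  Candidate = Σ (Fin (n G)) λ k → Σ (Vec V (suc (toℕ k))) λ _ → Vec Bool (m G)

  -- The default 0 lies below the value 1 of a single vertex without edges, so a maximiser is
  -- necessarily injective.
  value : Candidate → ℕ
  value (k , us , fs) = if does (injective? (lookup us)) then absDet (lookup fs) (lookup us) else 0

  value-injective : ∀ k us fs → (∀ i j → lookup us i ≡ lookup us j → i ≡ j) →
    value (k , us , fs) ≡ absDet (lookup fs) (lookup us)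
  value-injective k us fs inj = cong (if_then absDet (lookup fs) (lookup us) else 0) (dec-true (injective? (lookup us)) inj)

  value-tabulate : ∀ F (k : Fin (n G)) {l} → toℕ k ≡ l → (u : Fin (suc l) → V) → Injective _≡_ _≡_ u → ∃ λ c → absDet F u ≡ value c
  value-tabulate F k refl u u-inj = (k , tabulate u , tabulate F) , trans
    (absDet-cong (sym ∘ lookup∘tabulate F) (sym ∘ lookup∘tabulate u))
    (sym (value-injective k (tabulate u) (tabulate F) λ i j eq → u-inj
      (trans (sym (lookup∘tabulate u i)) (trans eq (lookup∘tabulate u j)))))

  optimum : 1 ≤ n G → Optimum
  optimum 1≤n = best⇒optimum
    (Σ-max (Fin-max 1≤n) (λ k → Σ-max (Vec-max (Fin-max 1≤n) _) λ _ → Vec-max Bool-max _) value)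
    where
    best⇒optimum : (∃ λ c → ∀ c′ → value c′ ≤ value c) → Optimum
    best⇒optimum ((k , us , fs) , best) = result (injective? (lookup us))
      where
      bound : ∀ F {l} (u : Fin (suc l) → V) → Injective _≡_ _≡_ u → absDet F u ≤ value (k , us , fs)
      -- Injectivity gives suc l ≤ n, which is l < n, so l itself is a legitimate length index in
      -- `Fin (n G)`.
      bound F u u-inj with value-tabulate F (fromℕ< (Fin.injective⇒≤ u-inj)) (Fin.toℕ-fromℕ< (Fin.injective⇒≤ u-inj)) u u-inj
      ... | c , eq = ℕ.≤-trans (ℕ.≤-reflexive eq) (best c)
      1≤best : 1 ≤ value (k , us , fs)
      1≤best = ℕ.≤-trans (ℕ.≤-reflexive (sym (absDet-single (fromℕ< 1≤n))))
        (bound (λ _ → false) {0} (λ _ → fromℕ< 1≤n) λ { {zero} {zero} _ → refl })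
      bound₀ : ∀ F {l} (u : Fin l → V) → Injective _≡_ _≡_ u → absDet F u ≤ value (k , us , fs)
      bound₀ F {zero}  u u-inj = ℕ.≤-trans (ℕ.≤-reflexive (absDet-empty F u)) 1≤best
      bound₀ F {suc l} u u-inj = bound F u u-inj
      result : Dec (∀ i j → lookup us i ≡ lookup us j → i ≡ j) → Optimum
      result (yes inj) = record
        { edges = lookup fs ; verts = lookup us ; inj = inj _ _
        ; optimal = λ F u u-inj → ℕ.≤-trans (bound₀ F u u-inj) (ℕ.≤-reflexive (value-injective k us fs inj)) }
      result (no ¬inj) = contradiction (ℕ.≤-trans 1≤best (ℕ.≤-reflexive
        (cong (if_then absDet (lookup fs) (lookup us) else 0) (dec-false (injective? (lookup us)) ¬inj)))) λ ()

  -- Discarding vertices with fewer than two edges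

  At : EdgeSet → V → E → Set
  At F v e = F e ≡ true × Inc v e

  at? : ∀ F v e → Dec (At F v e)
  at? F v e = (F e Bool.≟ true) ×-dec inc? v e

  Branching : EdgeSet → V → Set
  Branching F v = ∃ λ e → ∃ λ f → At F v e × At F v f × e ≢ f

  branching? : ∀ F v → Dec (Branching F v)
  branching? F v = Fin.any? λ e → Fin.any? λ f → at? F v e ×-dec (at? F v f ×-dec ¬? (e Fin.≟ f))

  Branching⇒deg≥2 : ∀ F v → Branching F v → 2 ≤ deg G (spanning F) v
  Branching⇒deg≥2 F v (e , f , at-e , at-f , e≢f) = count≥2 (m G) _ e f e≢f (true-at at-e) (true-at at-f)
    where
    true-at : ∀ {e} → At F v e → F e ∧ incVE G v e ≡ true
    true-at {e} (Fe , inc) = cong₂ _∧_ Fe (dec-true (inc? v e) inc)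

  KV-isolated : ∀ F {v} → ¬ ∃ (At F v) → ∀ w → KV F v w ≡ M (inj₁ v) (inj₁ w)
  KV-isolated F {v} ¬at w = K≡M F (inj₁ v) (inj₁ w) λ f Ff →
    trans (cong (_* M (inj₂ f) (inj₁ w)) (M-¬inc λ inc → ¬at (f , Ff , inc))) (*-zeroˡ (M (inj₂ f) (inj₁ w)))

  KV-pendant : ∀ F {v e} → At F v e → (∀ f → At F v f → f ≡ e) →
    ∀ w → KV F v w ≡ M (inj₁ v) (inj₁ w) - M (inj₁ w) (inj₂ e)
  KV-pendant F {v} {e} (Fe , inc) only w = cong (λ z → M (inj₁ v) (inj₁ w) - z) (trans (Sum-single e others) at-e)
    where
    others : ∀ f → f ≢ e → term F (inj₁ v) (inj₁ w) f ≡ + 0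
    others f f≢e = term-0 F (inj₁ v) (inj₁ w) f λ Ff →
      trans (cong (_* M (inj₂ f) (inj₁ w)) (M-¬inc λ inc → f≢e (only f (Ff , inc)))) (*-zeroˡ (M (inj₂ f) (inj₁ w)))
    at-e : term F (inj₁ v) (inj₁ w) e ≡ M (inj₁ w) (inj₂ e)
    at-e rewrite Fe = trans (cong (_* M (inj₂ e) (inj₁ w)) (M-inc inc)) (*-identityˡ (M (inj₂ e) (inj₁ w)))

  record Smaller (F : EdgeSet) {k} (u : Fin k → V) : Set where
    field
      {l}    : ℕ
      verts  : Fin l → V
      inj    : Injective _≡_ _≡_ verts
      l<k    : l < k
      absDet≡ : absDet F verts ≡ absDet F u

  -- In I - BBᵀ an isolated vertex has a unit row. A vertex of degree 1 has diagonal entry 1 - 1 = 0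
  -- and a single entry -1, at its neighbour; without that column its row would vanish.
  drop-nonbranching : ∀ F {k} (u : Fin k → V) → Injective _≡_ _≡_ u → absDet F u ≢ 0 →
    ∀ i → ¬ Branching F (u i) → Smaller F u
  drop-nonbranching F {suc k} u u-inj ≢0 i ¬branching with Fin.any? (at? F (u i))
  ... | no ¬at = record
    { verts = u ∘ punchIn i
    ; inj = punchIn-injective i u-inj
    ; l<k = ℕ.≤-refl
    ; absDet≡ = sym (cong ∣_∣ (trans (Det-toFront-principal (KV F) u i) (trans
        (Det-unitRow _ λ j → trans (KV-isolated F ¬at _) (M-vertices (punchIn-avoids i u-inj j ∘ sym)))
        (trans (cong (_* Det k (sub (KV F) (u ∘ punchIn i) (u ∘ punchIn i)))
          (trans (KV-isolated F ¬at (u i)) (M-diag (inj₁ (u i))))) (*-identityˡ _)))))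
    }
  ... | yes (e , at-e) = pendant (Fin.any? λ j → rest j Fin.≟ w)
    where
    v : V
    v = u i
    rest : Fin k → V
    rest = u ∘ punchIn i
    w : V
    w = proj₁ (otherEnd (proj₂ at-e))
    vw : Joins e v w
    vw = proj₂ (otherEnd (proj₂ at-e))
    only : ∀ f → At F v f → f ≡ e
    only f at-f with f Fin.≟ e
    ... | yes f≡e = f≡e
    ... | no f≢e  = contradiction (f , e , at-f , at-e , f≢e) ¬branching
    KVvv : KV F v v ≡ + 0
    KVvv = trans (KV-pendant F at-e only v) (cong₂ _-_ (M-diag (inj₁ v)) (M-inc (proj₂ at-e)))
    KVvw : KV F v w ≡ -[1+ 0 ]
    KVvw = trans (KV-pendant F at-e only w) (cong₂ _-_
      (M-vertices λ v≡w → Joins-irrefl (subst (Joins e v) (sym v≡w) vw)) (M-inc (Joins⇒Incˡ (Joins-sym vw))))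
    KVv-other : ∀ {x} → x ≢ v → x ≢ w → KV F v x ≡ + 0
    KVv-other {x} x≢v x≢w = trans (KV-pendant F at-e only x) (cong₂ _-_ (M-vertices (x≢v ∘ sym))
      (M-¬inc λ inc → [ x≢v , x≢w ]′ (Joins-ends vw inc)))
    pendant : Dec (∃ λ j → rest j ≡ w) → Smaller F u
    pendant (no w∉rest) = contradiction (cong ∣_∣ (trans (Det-toFront-principal (KV F) u i) (trans
      (Det-unitRow _ λ j → KVv-other (punchIn-avoids i u-inj j) λ eq → w∉rest (j , eq))
      (cong (_* Det k (sub (KV F) rest rest)) KVvv)))) ≢0
    pendant (yes (j , eq)) = pair k rest (punchIn-injective i u-inj) (punchIn-avoids i u-inj)
      (Det-toFront-principal (KV F) u i) refl j eq
      where
      -- The length is generalised so that it can be split as a successor, which `punchIn j`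
      -- requires.
      pair : ∀ l (rest : Fin l → V) → Injective _≡_ _≡_ rest → (∀ a → rest a ≢ v) →
        Det (suc k) (sub (KV F) u u) ≡ Det (suc l) (sub (KV F) (v ◂ rest) (v ◂ rest)) → l ≡ k →
        ∀ j → rest j ≡ w → Smaller F u
      pair (suc l) rest rest-inj ≢v start refl j rj≡w = record
        { verts = rest′ ; inj = punchIn-injective j rest-inj ; l<k = ℕ.n≤1+n _
        ; absDet≡ = sym (trans (cong ∣_∣ chain) (∣-i∣≡∣i∣ (Det l (sub (KV F) rest′ rest′)))) }
        where
        rest′ : Fin l → V
        rest′ = rest ∘ punchIn j
        -- The columns stand in the order w, v while the rows of B stand in the order v, w. Both
        -- leading diagonal entries of B are then -1, with zeros to the right of the first and, in
        -- the remaining minor, below the second.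
        q : Fin (suc (suc l)) → V
        q = w ◂ v ◂ rest′
        row : V → Fin (suc (suc l)) → ℤ
        row x b = KV F x (q b)
        B : Matrix (suc (suc l))
        B = row v ◂ row w ◂ (row ∘ rest′)
        ≢w : ∀ a → rest′ a ≢ w
        ≢w a eq = punchIn-avoids j rest-inj a (trans eq (sym rj≡w))
        reorder : ∀ a → toFront (suc j) (v ◂ rest) a ≡ q a
        reorder zero          = rj≡w
        reorder (suc zero)    = refl
        reorder (suc (suc a)) = refl
        row-v : ∀ b → B zero (suc b) ≡ + 0
        row-v zero    = KVvv
        row-v (suc b) = KVv-other (≢v (punchIn j b)) (≢w b)
        chain : Det (suc (suc l)) (sub (KV F) u u) ≡ - Det l (sub (KV F) rest′ rest′)
        chain = begin
          Det (suc (suc l)) (sub (KV F) u u)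
            ≡⟨ trans start (Det-toFront-principal (KV F) (v ◂ rest) (suc j)) ⟩
          Det (suc (suc l)) (sub (KV F) (toFront (suc j) (v ◂ rest)) (toFront (suc j) (v ◂ rest)))
            ≡⟨ Det-cong (λ a b → cong₂ (KV F) (reorder a) (reorder b)) ⟩
          Det (suc (suc l)) (sub (KV F) q q)
            ≡⟨ Det-cong (λ { zero b → refl ; (suc zero) b → refl ; (suc (suc a)) b → refl }) ⟩
          Det (suc (suc l)) (row w ◂ row v ◂ (row ∘ rest′))
            ≡⟨ Det-swap (row w) (row v) (row ∘ rest′) ⟩
          - Det (suc (suc l)) B
            ≡⟨ cong -_ (Det-unitRow B row-v) ⟩
          - (KV F v w * Det (suc l) (minor₀ B))
            ≡⟨ cong₂ (λ a b → - (a * b)) KVvw (Det-unitCol (minor₀ B) λ a →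
                 trans (K-sym F (inj₁ (rest′ a)) (inj₁ v)) (KVv-other (≢v (punchIn j a)) (≢w a))) ⟩
          - (-[1+ 0 ] * (KV F w v * Det l (sub (KV F) rest′ rest′)))
            ≡⟨ cong (λ a → - (-[1+ 0 ] * (a * Det l (sub (KV F) rest′ rest′)))) (trans (K-sym F (inj₁ w) (inj₁ v)) KVvw) ⟩
          - (-[1+ 0 ] * (-[1+ 0 ] * Det l (sub (KV F) rest′ rest′)))
            ≡⟨ cong -_ (trans (-1*i≡-i _) (trans (cong -_ (-1*i≡-i _)) (neg-involutive _))) ⟩
          - Det l (sub (KV F) rest′ rest′) ∎

  -- Dropping removes one or two vertices at a time, so the bound b carries the recursion. The value
  -- stays the same, hence nonzero, and the resulting family may be empty.
  reduce-to-branching : ∀ F b {k} → k ≤ b → (u : Fin k → V) → Injective _≡_ _≡_ u → absDet F u ≢ 0 →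
    ∃ λ l → ∃ λ (u′ : Fin l → V) → Injective _≡_ _≡_ u′ × (∀ i → Branching F (u′ i)) × absDet F u′ ≡ absDet F u
  reduce-to-branching F b {k} k≤b u u-inj ≢0 with Fin.any? (λ i → ¬? (branching? F (u i)))
  ... | no all = k , u , u-inj , branching , refl
    where
    branching : ∀ i → Branching F (u i)
    branching i with branching? F (u i)
    ... | yes br = br
    ... | no ¬br = contradiction (i , ¬br) all
  reduce-to-branching F zero    ℕ.z≤n u u-inj ≢0 | yes (() , _)
  reduce-to-branching F (suc b) k≤b u u-inj ≢0 | yes (i , ¬br)
    with drop-nonbranching F u u-inj ≢0 i ¬br
  ... | record { verts = u′ ; inj = u′-inj ; l<k = l<k ; absDet≡ = eq }
    with reduce-to-branching F b (ℕ.≤-pred (ℕ.≤-trans l<k k≤b)) u′ u′-inj (λ z → ≢0 (trans (sym eq) z))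
  ... | l , u″ , u″-inj , br , eq′ = l , u″ , u″-inj , br , trans eq′ eq

  module Trim (F : EdgeSet) {k} (u : Fin (suc k) → V) where

    touched? : ∀ f → Dec (∃ λ i → Inc (u i) f)
    touched? f = Fin.any? λ i → inc? (u i) f

    trim : EdgeSet
    trim f = F f ∧ does (touched? f)

    -- An edge missing all of u has zero incidence with every row index.
    trim-absDet : absDet trim u ≡ absDet F u
    trim-absDet = cong ∣_∣ (Det-cong λ i j → cong (λ z → M (inj₁ (u i)) (inj₁ (u j)) - z) (Sum-cong (same i j)))
      where
      same : ∀ i j f → term trim (inj₁ (u i)) (inj₁ (u j)) f ≡ term F (inj₁ (u i)) (inj₁ (u j)) f
      same i j f = by-cases (touched? f)
        where
        product : ℤ
        product = M (inj₁ (u i)) (inj₂ f) * M (inj₂ f) (inj₁ (u j))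
        by-cases : Dec (∃ λ i → Inc (u i) f) → term trim (inj₁ (u i)) (inj₁ (u j)) f ≡ term F (inj₁ (u i)) (inj₁ (u j)) f
        by-cases (yes t) = cong (if_then product else + 0)
          (trans (cong (F f ∧_) (dec-true (touched? f) t)) (∧-identityʳ (F f)))
        by-cases (no ¬t) = trans
          (cong (if_then product else + 0) (trans (cong (F f ∧_) (dec-false (touched? f) ¬t)) (∧-zeroʳ (F f))))
          (sym (term-0 F (inj₁ (u i)) (inj₁ (u j)) f λ _ →
            trans (cong (_* M (inj₂ f) (inj₁ (u j))) (M-¬inc λ inc → ¬t (i , inc))) (*-zeroˡ (M (inj₂ f) (inj₁ (u j))))))

    trim-At : ∀ i {e} → At F (u i) e → At trim (u i) e
    trim-At i {e} (Fe , inc) = cong₂ _∧_ Fe (dec-true (touched? e) (i , inc)) , inc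

    -- Trimming keeps every edge of F at a vertex of u, so the two edges witnessing `Branching`
    -- survive.
    trim-good : (u-inj : Injective _≡_ _≡_ u) → (∀ i → Branching F (u i)) →
      GoodPair G (spanning trim) (induced trim u u-inj)
    trim-good u-inj br =
        (λ e te → covered (does⇒ (touched? e) (proj₂ (∧-true {F e} te))))
      , λ i → Branching⇒deg≥2 trim (u i) (branching i (br i))
      where
      covered : ∀ {e} → (∃ λ i → Inc (u i) e) → (Σ _ λ i → u i ≡ src G e) ⊎ (Σ _ λ i → u i ≡ tgt G e)
      covered (i , inj₁ eq) = inj₁ (i , sym eq)
      covered (i , inj₂ eq) = inj₂ (i , sym eq)
      branching : ∀ i → Branching F (u i) → Branching trim (u i)
      branching i (e , f , at-e , at-f , e≢f) = e , f , trim-At i at-e , trim-At i at-f , e≢f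

  all-edges : EdgeSet
  all-edges _ = true

  -- Two different successive edges of a path make their common vertex branching; a path without
  -- such a pair runs back and forth along one edge.
  reach : ∀ {v w} → Reachable G v w → w ≡ v ⊎ Adj G v w ⊎ ∃ (Branching all-edges)
  reach here = inj₁ refl
  reach {v} (there {v = u} (e , vu) path) with reach path
  ... | inj₁ refl = inj₂ (inj₁ (e , vu))
  ... | inj₂ (inj₂ br) = inj₂ (inj₂ br)
  ... | inj₂ (inj₁ (f , uw)) with e Fin.≟ f
  ...   | no e≢f = inj₂ (inj₂ (u , e , f , (refl , Joins⇒Incˡ (Joins-sym vu)) , (refl , Joins⇒Incˡ uw) , e≢f))
  ...   | yes refl with Joins-ends vu (Joins⇒Incˡ (Joins-sym uw))
  ...     | inj₁ w≡v = inj₁ w≡v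
  ...     | inj₂ refl = contradiction uw Joins-irrefl

  two-neighbours : ∀ {v a b} → a ≢ b → Adj G v a → Adj G v b → ∃ (Branching all-edges)
  two-neighbours {v} {a} {b} a≢b (e , va) (f , vb) = v , e , f , (refl , Joins⇒Incˡ va) , (refl , Joins⇒Incˡ vb) , e≢f
    where
    e≢f : e ≢ f
    e≢f refl with Joins-ends va (Joins⇒Incˡ (Joins-sym vb))
    ... | inj₁ refl = Joins-irrefl vb
    ... | inj₂ b≡a  = a≢b (sym b≡a)

  -- At most one of three distinct reachable vertices is v. Unless `reach` already found a branching
  -- vertex, two others are neighbours of v, and v itself branches.
  branching-vertex : ComponentsAtLeast3 G → V → ∃ (Branching all-edges)
  branching-vertex comps v with comps v
  ... | f , f-inj , r with reach (r zero) | reach (r (suc zero)) | reach (r (suc (suc zero)))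
  ... | inj₂ (inj₂ br) | _ | _ = br
  ... | _ | inj₂ (inj₂ br) | _ = br
  ... | _ | _ | inj₂ (inj₂ br) = br
  ... | inj₂ (inj₁ p) | inj₂ (inj₁ q) | _ = two-neighbours (λ eq → contradiction (f-inj eq) λ ()) p q
  ... | inj₂ (inj₁ p) | inj₁ _ | inj₂ (inj₁ q) = two-neighbours (λ eq → contradiction (f-inj eq) λ ()) p q
  ... | inj₁ _ | inj₂ (inj₁ p) | inj₂ (inj₁ q) = two-neighbours (λ eq → contradiction (f-inj eq) λ ()) p q
  ... | inj₁ p | inj₁ q | _ = contradiction (f-inj (trans p (sym q))) λ ()
  ... | inj₁ p | inj₂ _ | inj₁ q = contradiction (f-inj (trans p (sym q))) λ ()
  ... | inj₂ _ | inj₁ p | inj₁ q = contradiction (f-inj (trans p (sym q))) λ ()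

  -- The only entry is 1 - deg v, with deg v at least 2.
  absDet-star : ∀ F v → Branching F v → 1 ≤ absDet F {1} (λ _ → v)
  absDet-star F v br with deg G (spanning F) v in eq | Branching⇒deg≥2 F v br
  ... | suc (suc d) | ℕ.s≤s (ℕ.s≤s _) = ℕ.≤-trans (ℕ.s≤s ℕ.z≤n) (ℕ.≤-reflexive (sym (cong ∣_∣ (trans (Det-unitRow _ λ ())
    (cong₂ _*_ (cong₂ _-_ (M-diag (inj₁ v)) (trans (Sum-deg (spanning F) v) (cong +_ eq))) (Det-zero _))))))

-- Both maxima equal the optimum

module FromOptimum (G : Graph) (1≤n : 1 ≤ n G) (opt : Pairs.Optimum G) where
  open Incidence G
  open EdgeElimination G
  open Pairs G
  open Optimum opt

  LdetAbs-induced : ∀ F {k} (u : Fin (suc k) → V) (u-inj : Injective _≡_ _≡_ u) → LdetAbs G (spanning F) (induced F u u-inj) ≡ absDet F u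
  LdetAbs-induced F u u-inj = LdetAbs≡ (spanning F) (induced F u u-inj)

  attained : Σ (SquareSub G) λ S → subDetAbs G S ≡ absDet edges verts
  attained with introduce-edges (allFin (m G)) edges (λ f _ → ∈-allFin f)
                  (inj₁ ∘ verts) (inj ∘ Sum.inj₁-injective) (λ _ _ ())
  ... | l , s , s-inj , eq = record { size = l ; rows = s ; cols = s ; rows-inj = s-inj ; cols-inj = s-inj }
      , cong ∣_∣ (trans (sym (Det≡det _ _)) eq)

  bounded : IsForest G → ∀ S → subDetAbs G S ≤ absDet edges verts
  bounded forest S with Peel.peeling G forest
  ... | L , P , L∋ with every-minor-principal P (rows S) (cols S) (rows-inj S) (cols-inj S) (L∋ ∘ rows S) (L∋ ∘ cols S)
  ... | principal {l} s s-inj _ ε ε-abs eq with eliminate-edges s s-inj (λ _ → false) (λ _ _ _ → refl)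
  ... | F , k , u , u-inj , eq′ = ℕ.≤-trans
    (ℕ.≤-reflexive (begin
      subDetAbs G S
        ≡⟨ cong ∣_∣ (sym (Det≡det _ _)) ⟩
      ∣ Det _ (sub M (rows S) (cols S)) ∣
        ≡⟨ cong ∣_∣ (trans (Det-cong λ i j → M≡entry (rows S i) (cols S j)) (eq λ _ → + 1)) ⟩
      ∣ ε * minor l (λ _ → + 1) s s ∣
        ≡⟨ abs-* ε (minor l (λ _ → + 1) s s) ⟩
      ∣ ε ∣ ℕ.* ∣ minor l (λ _ → + 1) s s ∣
        ≡⟨ cong (λ z → ∣ ε ∣ ℕ.* ∣ z ∣) (trans (Det-cong λ i j → trans (sym (M≡entry (s i) (s j)))
             (sym (K≡M (λ _ → false) (s i) (s j) λ _ ()))) eq′) ⟩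
      ∣ ε ∣ ℕ.* absDet F u ∎))
    (ℕ.≤-trans (ℕ.*-mono-≤ ε-abs (optimal F u u-inj)) (ℕ.≤-reflexive (ℕ.*-identityˡ _)))
    where
    -- The generic diagonal is specialised to 1 only here, after the minor has become principal.
    M≡entry : ∀ x y → M x y ≡ entry (λ _ → + 1) x y
    M≡entry x y with x ≟ᴱ y
    ... | yes refl = M-diag x
    ... | no _     = refl

  attainedL : Σ (Subgraph G) λ G′ → Σ (Induced G G′) λ G″ → LdetAbs G G′ G″ ≡ absDet edges verts
  attainedL = spanning edges , induced edges verts inj , LdetAbs-induced edges verts inj

  boundedL : ∀ G′ G″ → LdetAbs G G′ G″ ≤ absDet edges verts
  boundedL G′ G″ = ℕ.≤-trans (ℕ.≤-reflexive (LdetAbs≡ G′ G″)) (optimal (es G′) (vtx G″) (vtx-inj G″))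

  1≤optimum : 1 ≤ absDet edges verts
  1≤optimum = ℕ.≤-trans (ℕ.≤-reflexive (sym (absDet-empty edges (λ ())))) (optimal edges (λ ()) λ { {()} })

  good : ComponentsAtLeast3 G →
    Σ (Subgraph G) λ G′ → Σ (Induced G G′) λ G″ → LdetAbs G G′ G″ ≡ absDet edges verts × GoodPair G G′ G″
  good comps with reduce-to-branching edges _ ℕ.≤-refl verts inj (λ eq → ℕ.<⇒≢ 1≤optimum (sym eq))
  ... | suc l , u , u-inj , br , eq = spanning trim , induced trim u u-inj
      , trans (LdetAbs-induced trim u u-inj) (trans trim-absDet eq) , trim-good u-inj br
    where open Trim edges u
  ... | zero , u , _ , _ , eq with branching-vertex comps (fromℕ< 1≤n)
  -- The pair starts from all edges of G, and trimming leaves the star at v. Its value is at least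
  -- 1, which is the optimum since the family reduced to the empty one, and optimality gives the
  -- other inequality.
  ...   | v , br = spanning trim , induced trim star star-inj
      , trans (LdetAbs-induced trim star star-inj) (trans trim-absDet (ℕ.≤-antisym
          (optimal all-edges star star-inj)
          (ℕ.≤-trans (ℕ.≤-reflexive (trans (sym eq) (absDet-empty edges u))) (absDet-star all-edges v br))))
      , trim-good star-inj λ _ → br
    where
    star : Fin 1 → V
    star _ = v
    star-inj : Injective _≡_ _≡_ star
    star-inj {zero} {zero} _ = refl
    open Trim all-edges star

theorem3 : (G : Graph) → IsForest G → 1 ≤ n G →
    Σ ℕ λ d → IsΔ G d × IsMaxL G d
    × (ComponentsAtLeast3 G →
    Σ (Subgraph G) λ G' → Σ (Induced G G') λ G'' → LdetAbs G G' G'' ≡ d × GoodPair G G' G'')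
theorem3 G forest 1≤n = absDet edges verts , (attained , bounded forest) , (attainedL , boundedL) , good
  where
  open Pairs G
  opt : Optimum
  opt = optimum 1≤n
  open Optimum opt
  open FromOptimum G 1≤n opt
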